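{- For each prime $p$ there is a finite solvable Malcev algebra $\mathbf A$ such that $\mathrm{nuP}_{\mathbf A}=\mathrm{nuDet}_p$.
   Context: An algebraic branching program (ABP) over $\mathrm{GF}(p)$ is a DAG (multiple edges allowed) with one source and one sink, edges labelled by variables or constants of $\mathrm{GF}(p)$; it computes the sum over source-to-sink paths of the product of labels; its size is the number of vertices plus edges. A $\mathrm{BABP}_p$ gate is labelled by an $n$-variate ABP over $\mathrm{GF}(p)$ and a set $T\subseteq\mathrm{GF}(p)$; on Boolean inputs $b\in\{0,1\}^n$ it outputs 1 iff the computed polynomial evaluated at $b$ lies in $T$; its size is that of the ABP. $\mathrm{nuDet}_p$ is the class of languages $L\subseteq\{0,1\}^*$ such that for each $n$, $L\cap\{0,1\}^n$ is recognized by a single $\mathrm{BABP}_p$ gate of size polynomial in $n$. For a finite algebra $\mathbf A$, a NuDFA is $((t_n),\iota,S)$ with $t_n$ an $n$-input circuit over $\mathbf A$ (sources variables or constants of $A$, gates basic operations), $\iota:\{0,1\}\to A$, $S\subseteq A$, accepting $b$ iff $t_n(\iota(b_1),\dots,\iota(b_n))\in S$; $\mathrm{nuP}_{\mathbf A}$ is the class of languages recognized by NuDFAs of polynomially bounded circuit size. Malcev: has a term $d$ with $d(x,y,y)=d(y,y,x)=x$; solvable in the sense of commutator theory. -}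

module Defs where

open import Level using (Level; 0ℓ) renaming (suc to lsuc)
open import Data.Nat using (ℕ; zero; suc; _+_; _*_; _^_; _≤_; _<_; NonZero)
open import Data.Nat.DivMod using (_mod_)
open import Data.Fin using (Fin; toℕ; fromℕ; _≟_) renaming (zero to fzero; suc to fsuc)
open import Data.Bool using (Bool; true; false; if_then_else_)
open import Data.Vec using (Vec; []; _∷_; _∷ʳ_; lookup; last; toList)
open import Data.List using (List; []; _∷_; _++_; map; concatMap; length)
open import Data.Nat.ListAction using (sum; product)
open import Data.List.Relation.Unary.All using (All)
open import Data.Sum using (_⊎_; [_,_])
open import Data.Product using (Σ; ∃; _×_; _,_)
open import Relation.Binary.PropositionalEquality using (_≡_)
open import Relation.Nullary using (does)

record FiniteAlgebra : Set where
  field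
    size   : ℕ
    nops   : ℕ
    arity  : Fin nops → ℕ
    op     : (f : Fin nops) → (Fin (arity f) → Fin size) → Fin size

module _ (A : FiniteAlgebra) where
  open FiniteAlgebra A

  data Term (X : Set) : Set where
    var : X → Term X
    app : (f : Fin nops) → (Fin (arity f) → Term X) → Term X

  eval : {X : Set} → Term X → (X → Fin size) → Fin size
  eval (var x)    ρ = ρ x
  eval (app f ts) ρ = op f (λ i → eval (ts i) ρ)

  Malcev : Set
  Malcev = Σ (Term (Fin 3)) λ d → ∀ x y →
    (eval d (lookup (x ∷ y ∷ y ∷ [])) ≡ x) × (eval d (lookup (y ∷ y ∷ x ∷ [])) ≡ x)

  Rel : Set₁
  Rel = Fin size → Fin size → Set

  record IsCongruence (θ : Rel) : Set where
    field
      refl′  : ∀ x → θ x x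
      sym′   : ∀ {x y} → θ x y → θ y x
      trans′ : ∀ {x y z} → θ x y → θ y z → θ x z
      compat : ∀ f (a b : Fin (arity f) → Fin size) →
               (∀ i → θ (a i) (b i)) → θ (op f a) (op f b)

  TC : Rel → Rel → Rel → Set
  TC α β δ = ∀ (m n : ℕ) (t : Term (Fin m ⊎ Fin n))
    (a b : Fin m → Fin size) (c d : Fin n → Fin size) →
    (∀ i → α (a i) (b i)) → (∀ j → β (c j) (d j)) →
    δ (eval t [ a , c ]) (eval t [ a , d ]) →
    δ (eval t [ b , c ]) (eval t [ b , d ])

  IsCommutator : Rel → Rel → Rel → Set₁
  IsCommutator α β γ = IsCongruence γ × TC α β γ ×
    (∀ (δ : Rel) → IsCongruence δ → TC α β δ → ∀ x y → γ x y → δ x y)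

  Solvable : Set₁
  Solvable = Σ ℕ λ n → Σ (ℕ → Rel) λ θ →
    (∀ x y → θ 0 x y) ×
    (∀ i → IsCommutator (θ i) (θ i) (θ (suc i))) ×
    (∀ x y → θ n x y → x ≡ y)

  -- circuits as straight-line programs: gate j may use inputs,
  -- constants, or a basic operation applied to earlier gates (Fin j)
  data Gate (n j : ℕ) : Set where
    input : Fin n → Gate n j
    const : Fin size → Gate n j
    gate  : (f : Fin nops) → (Fin (arity f) → Fin j) → Gate n j

  data Circuit (n : ℕ) : ℕ → Set where
    []  : Circuit n 0
    _▷_ : ∀ {j} → Circuit n j → Gate n j → Circuit n (suc j)

  evalGate : ∀ {n j} → Gate n j → (Fin n → Fin size) → Vec (Fin size) j → Fin size
  evalGate (input i)  x v = x i
  evalGate (const a)  x v = a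
  evalGate (gate f g) x v = op f (λ i → lookup v (g i))

  evalCircuit : ∀ {n j} → Circuit n j → (Fin n → Fin size) → Vec (Fin size) j
  evalCircuit []      x = []
  evalCircuit (c ▷ g) x = let v = evalCircuit c x in v ∷ʳ evalGate g x v

  output : ∀ {n s} → Circuit n (suc s) → (Fin n → Fin size) → Fin size
  output c x = last (evalCircuit c x)

  -- languages recognised by polynomial-size NuDFAs over A
  nuP : (List Bool → Set) → Set
  nuP L = Σ (Bool → Fin size) λ ι → Σ (Fin size → Bool) λ S →
    Σ (ℕ → ℕ) λ s → Σ ((n : ℕ) → Circuit n (suc (s n))) λ t →
      (Σ ℕ λ c → ∀ n → suc (s n) ≤ c * n ^ c + c) ×
      (∀ n (b : Vec Bool n) →
        (L (toList b) → S (output (t n) (λ i → ι (lookup b i))) ≡ true) ×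
        (S (output (t n) (λ i → ι (lookup b i))) ≡ true → L (toList b)))

data Label (p n : ℕ) : Set where
  var : Fin n → Label p n
  cst : Fin p → Label p n

record Edge (p n V : ℕ) : Set where
  field
    from  : Fin V
    to    : Fin V
    label : Label p n

-- vertices Fin (suc v), source = 0, sink = v (largest index);
-- every edge goes from a smaller to a larger index (hence a DAG)
record ABP (p n : ℕ) : Set where
  field
    v     : ℕ
    edges : List (Edge p n (suc v))
    dag   : All (λ e → toℕ (Edge.from e) < toℕ (Edge.to e)) edges

  source sink : Fin (suc v)
  source = fzero
  sink   = fromℕ v

  paths : ℕ → Fin (suc v) → List (List (Label p n))
  paths fuel u = here ++ more fuel
    where
    here : List (List (Label p n))
    here = if does (u ≟ sink) then [] ∷ [] else []
    more : ℕ → List (List (Label p n))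
    more zero     = []
    more (suc f)  = concatMap (λ e → if does (Edge.from e ≟ u)
                                      then map (Edge.label e ∷_) (paths f (Edge.to e))
                                      else []) edges

  allPaths : List (List (Label p n))
  allPaths = paths (suc v) source

  absize : ℕ
  absize = suc v + length edges

labelVal : ∀ {p n} → Vec Bool n → Label p n → ℕ
labelVal b (var i) = if lookup b i then 1 else 0
labelVal b (cst c) = toℕ c

abpEval : ∀ {p n} .{{_ : NonZero p}} → ABP p n → Vec Bool n → Fin p
abpEval {p} g b =
  sum (map (λ π → product (map (labelVal b) π)) (ABP.allPaths g)) mod p

-- languages recognised by polynomial-size BABP_p gates
nuDet : (p : ℕ) .{{_ : NonZero p}} → (List Bool → Set) → Set
nuDet p L = Σ ((n : ℕ) → ABP p n) λ g → Σ ((n : ℕ) → Fin p → Bool) λ T →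
  (Σ ℕ λ c → ∀ n → ABP.absize (g n) ≤ c * n ^ c + c) ×
  (∀ n (b : Vec Bool n) →
    (L (toList b) → T n (abpEval (g n) b) ≡ true) ×
    (T n (abpEval (g n) b) ≡ true → L (toList b)))

-- The algebra is 𝔸 = ℤₚ × ℤₚ with the Malcev operation d(x, y, z) = x − y + z and
-- f((a, z), (a′, z′), (a″, z″)) = (a + a′ z″, 0). Its commutator [1, 1] is θ₁ = "same second
-- coordinate", and [θ₁, θ₁] = 0 because on θ₁-classes f is affine; so 𝔸 is solvable.
--
-- In a circuit over 𝔸 the second coordinates are affine functions of the input bits, and the first
-- coordinates are sums of products of labels along paths, i.e. the value of an algebraic branching
-- program; conversely f(acc, v, ℓ) = acc + v ℓ lets a circuit evaluate any ABP node by node. Both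
-- acceptance conditions become nonvanishing of a polynomial over the field ℤₚ: ∏_{s ∉ P} (x − s) is
-- nonzero exactly when P x, and ∑_β [z = β] · [S (a, β)] decides S (a, z).

module Submission where

open import Defs
open import Level using (0ℓ)
open import Data.Nat as ℕ using (ℕ; zero; suc; NonZero; _%_; _∸_; _≤_; _<_; z≤n; s≤s; nonTrivial⇒n>1)
import Data.Nat.Properties as ℕ
open import Data.Nat.DivMod using (_mod_; %-distribˡ-+; %-distribˡ-*; n%n≡0; m<n⇒m%n≡m)
open import Data.Nat.Divisibility using (_∣_; m%n≡0⇒n∣m; n∣m⇒m%n≡0)
open import Data.Nat.ListAction using (sum; product)
open import Data.Nat.Primality using (Prime; euclidsLemma; prime⇒nonTrivial)
open import Data.Nat.Tactic.RingSolver using (solve-∀)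
open import Data.Integer as ℤ using (ℤ; -[1+_]; _⊖_; sign; ∣_∣; _◃_)
import Data.Integer.Properties as ℤ
open import Data.Sign as Sign using (Sign)
open import Data.Fin using (Fin; toℕ; fromℕ; fromℕ<; inject₁; opposite; punchIn; combine; remQuot; _≟_)
  renaming (zero to fzero; suc to fsuc)
import Data.Fin.Properties as Fin
open import Data.Fin.Patterns using (0F; 1F; 2F)
open import Data.Fin.Relation.Unary.Top using (view; ‵fromℕ; ‵inject₁)
open import Data.Bool using (Bool; true; false; not; T; if_then_else_)
open import Data.Bool.Properties using (T?; T-≡)
open import Data.Unit using (⊤; tt)
open import Data.Empty using (⊥-elim)
open import Data.Maybe using (Maybe; just; nothing)
open import Data.Product using (Σ; _×_; _,_; _,′_; proj₁; proj₂)
open import Data.Sum as Sum using (_⊎_; inj₁; inj₂; [_,_])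
open import Data.Vec using (Vec; []; _∷_; _∷ʳ_; lookup; toList)
import Data.Vec.Properties as Vec
open import Data.List using (List; []; _∷_; _++_; map; foldr; concat; concatMap; length; replicate; tabulate; allFin; filterᵇ)
import Data.List.Properties as List
open import Data.List.Membership.Propositional using (_∈_)
open import Data.List.Membership.Propositional.Properties using (∈-filter⁺; ∈-filter⁻; ∈-allFin)
open import Data.List.Relation.Unary.Any using (here; there)
open import Data.List.Relation.Unary.All as All using (All; []; _∷_)
import Data.List.Relation.Unary.All.Properties as All
open import Function using (_∘_; id; _⇔_; mk⇔; Equivalence)
open import Function.Properties.Equivalence using (⇔-setoid)
open import Relation.Nullary using (does; yes; no; contradiction)
open import Relation.Nullary.Decidable using (dec-true; dec-false)
open import Relation.Binary.PropositionalEquality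
  using (_≡_; _≢_; refl; sym; trans; cong; cong₂; subst; subst₂; isEquivalence; module ≡-Reasoning)
open import Algebra.Bundles using (CommutativeRing)
import Algebra.Solver.Ring
import Algebra.Solver.Ring.AlmostCommutativeRing as ACR
import Algebra.Properties.Ring
import Algebra.Properties.AbelianGroup
import Algebra.Properties.CommutativeSemigroup
import Algebra.Properties.Semiring.Sum

cong₃ : ∀ {A B C D : Set} (f : A → B → C → D) {a a′ b b′ c c′} →
        a ≡ a′ → b ≡ b′ → c ≡ c′ → f a b c ≡ f a′ b′ c′
cong₃ f refl refl refl = refl

concatMap-[] : ∀ {A B : Set} (xs : List A) → concatMap {B = B} (λ _ → []) xs ≡ []
concatMap-[] [] = refl
concatMap-[] (_ ∷ xs) = concatMap-[] xs

concatMap-cong-All : ∀ {A B : Set} {h h′ : A → List B} {xs} → All (λ x → h x ≡ h′ x) xs → concatMap h xs ≡ concatMap h′ xs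
concatMap-cong-All hs = cong concat (List.map-cong-local hs)

-- ℤ/pℤ

module IntegersModulo (p : ℕ) .{{_ : NonZero p}} where

  infixl 6 _+_
  infixl 7 _*_
  infix 8 -_

  toℕ-mod : ∀ n → toℕ (n mod p) ≡ n % p
  toℕ-mod n = Fin.toℕ-fromℕ< _

  mod-cong : ∀ {m n} → m % p ≡ n % p → m mod p ≡ n mod p
  mod-cong {m} {n} e = Fin.toℕ-injective (trans (toℕ-mod m) (trans e (sym (toℕ-mod n))))

  mod-toℕ : ∀ x → toℕ x mod p ≡ x
  mod-toℕ x = Fin.toℕ-injective (trans (toℕ-mod (toℕ x)) (m<n⇒m%n≡m (Fin.toℕ<n x)))

  0# 1# : Fin p
  0# = 0 mod p
  1# = 1 mod p

  -- Opaque, so that unification does not unfold the operations into stuck `_mod_` terms.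
  opaque
    _+_ _*_ : Fin p → Fin p → Fin p
    x + y = (toℕ x ℕ.+ toℕ y) mod p
    x * y = toℕ x ℕ.* toℕ y mod p

    -_ : Fin p → Fin p
    - x = (p ∸ toℕ x) mod p

    mod-distrib-+ : ∀ m n → (m ℕ.+ n) mod p ≡ m mod p + n mod p
    mod-distrib-+ m n = mod-cong (trans (%-distribˡ-+ m n p) (sym (cong₂ (λ a b → (a ℕ.+ b) % p) (toℕ-mod m) (toℕ-mod n))))

    mod-distrib-* : ∀ m n → m ℕ.* n mod p ≡ (m mod p) * (n mod p)
    mod-distrib-* m n = mod-cong (trans (%-distribˡ-* m n p) (sym (cong₂ (λ a b → (a ℕ.* b) % p) (toℕ-mod m) (toℕ-mod n))))

    toℕ-* : ∀ x y → toℕ (x * y) ≡ (toℕ x ℕ.* toℕ y) % p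
    toℕ-* x y = toℕ-mod _

    private
      mod-+ˡ : ∀ m y → m mod p + y ≡ (m ℕ.+ toℕ y) mod p
      mod-+ˡ m y = trans (cong (m mod p +_) (sym (mod-toℕ y))) (sym (mod-distrib-+ m (toℕ y)))

      mod-+ʳ : ∀ x n → x + n mod p ≡ (toℕ x ℕ.+ n) mod p
      mod-+ʳ x n = trans (cong (_+ n mod p) (sym (mod-toℕ x))) (sym (mod-distrib-+ (toℕ x) n))

      mod-*ˡ : ∀ m y → m mod p * y ≡ m ℕ.* toℕ y mod p
      mod-*ˡ m y = trans (cong ((m mod p) *_) (sym (mod-toℕ y))) (sym (mod-distrib-* m (toℕ y)))

      mod-*ʳ : ∀ x n → x * (n mod p) ≡ toℕ x ℕ.* n mod p
      mod-*ʳ x n = trans (cong (_* (n mod p)) (sym (mod-toℕ x))) (sym (mod-distrib-* (toℕ x) n))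

      +-assoc : ∀ x y z → (x + y) + z ≡ x + (y + z)
      +-assoc x y z = trans (mod-+ˡ _ z) (trans (cong (_mod p) (ℕ.+-assoc (toℕ x) (toℕ y) (toℕ z))) (sym (mod-+ʳ x _)))

      *-assoc : ∀ x y z → (x * y) * z ≡ x * (y * z)
      *-assoc x y z = trans (mod-*ˡ _ z) (trans (cong (_mod p) (ℕ.*-assoc (toℕ x) (toℕ y) (toℕ z))) (sym (mod-*ʳ x _)))

      +-comm : ∀ x y → x + y ≡ y + x
      +-comm x y = cong (_mod p) (ℕ.+-comm (toℕ x) (toℕ y))

      *-comm : ∀ x y → x * y ≡ y * x
      *-comm x y = cong (_mod p) (ℕ.*-comm (toℕ x) (toℕ y))

      +-identityˡ : ∀ x → 0# + x ≡ x
      +-identityˡ x = trans (mod-+ˡ 0 x) (mod-toℕ x)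

      *-identityˡ : ∀ x → 1# * x ≡ x
      *-identityˡ x = trans (mod-*ˡ 1 x) (trans (cong (_mod p) (ℕ.*-identityˡ (toℕ x))) (mod-toℕ x))

      *-distribˡ-+ : ∀ x y z → x * (y + z) ≡ x * y + x * z
      *-distribˡ-+ x y z = trans (mod-*ʳ x _) (trans (cong (_mod p) (ℕ.*-distribˡ-+ (toℕ x) (toℕ y) (toℕ z))) (mod-distrib-+ _ _))

      -‿inverseˡ : ∀ x → - x + x ≡ 0#
      -‿inverseˡ x = trans (mod-+ˡ _ x) (trans (cong (_mod p) (ℕ.m∸n+n≡m (ℕ.<⇒≤ (Fin.toℕ<n x))))
        (mod-cong (trans (n%n≡0 p) (sym (m<n⇒m%n≡m (ℕ.>-nonZero⁻¹ p))))))

  ℤₚ : CommutativeRing 0ℓ 0ℓ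
  ℤₚ = record
    { _≈_ = _≡_ ; _+_ = _+_ ; _*_ = _*_ ; -_ = -_ ; 0# = 0# ; 1# = 1#
    ; isCommutativeRing = record
      { isRing = record
        { +-isAbelianGroup = record
          { isGroup = record
            { isMonoid = record
              { isSemigroup = record
                { isMagma = record { isEquivalence = isEquivalence ; ∙-cong = cong₂ _+_ }
                ; assoc = +-assoc }
              ; identity = +-identityˡ , λ x → trans (+-comm x 0#) (+-identityˡ x) }
            ; inverse = -‿inverseˡ , λ x → trans (+-comm x (- x)) (-‿inverseˡ x)
            ; ⁻¹-cong = cong -_ }
          ; comm = +-comm }
        ; *-cong = cong₂ _*_
        ; *-assoc = *-assoc
        ; *-identity = *-identityˡ , λ x → trans (*-comm x 1#) (*-identityˡ x)
        ; distrib = *-distribˡ-+ , λ x y z → trans (*-comm (y + z) x)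
            (trans (*-distribˡ-+ x y z) (cong₂ _+_ (*-comm x y) (*-comm x z))) }
      ; *-comm = *-comm } }

  private module R = CommutativeRing ℤₚ
  open R public using (_-_)
  open Algebra.Properties.Semiring.Sum R.semiring public
    using (sum-syntax; sum-cong-≗; sum-replicate-zero; *-distribʳ-sum)
  open Algebra.Properties.Semiring.Sum R.semiring using (sum-remove)
  open Algebra.Properties.Ring R.ring using (-1*x≈-x)
  open Algebra.Properties.AbelianGroup R.+-abelianGroup
    using (⁻¹-∙-comm; ⁻¹-involutive; ε⁻¹≈ε; x∙y⁻¹≈ε⇒x≈y; x≈y⇒x∙y⁻¹≈ε)

  fromℤ : ℤ → Fin p
  fromℤ (ℤ.+ n) = n mod p
  fromℤ -[1+ n ] = - (suc n mod p)

  private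
    open ≡-Reasoning

    +-cancelˡ-- : ∀ c a b → (c + a) - (c + b) ≡ a - b
    +-cancelˡ-- c a b = begin
      (c + a) + - (c + b)    ≡⟨ cong ((c + a) +_) (sym (⁻¹-∙-comm c b)) ⟩
      (c + a) + (- c + - b)  ≡⟨ interchange c a (- c) (- b) ⟩
      (c - c) + (a - b)      ≡⟨ cong (_+ (a - b)) (R.-‿inverseʳ c) ⟩
      0# + (a - b)           ≡⟨ R.+-identityˡ (a - b) ⟩
      a - b                  ∎
      where open Algebra.Properties.CommutativeSemigroup R.+-commutativeSemigroup using (interchange)

    fromℤ-⊖ : ∀ m n → fromℤ (m ⊖ n) ≡ m mod p - n mod p
    fromℤ-⊖ m zero = begin
      fromℤ (m ⊖ 0)   ≡⟨ cong fromℤ (ℤ.⊖-≥ z≤n) ⟩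
      m mod p         ≡⟨ sym (R.+-identityʳ (m mod p)) ⟩
      m mod p + 0#    ≡⟨ cong (m mod p +_) (sym ε⁻¹≈ε) ⟩
      m mod p - 0#    ∎
    fromℤ-⊖ zero (suc n) = trans (cong fromℤ (ℤ.⊖-< (s≤s z≤n))) (sym (R.+-identityˡ (- (suc n mod p))))
    fromℤ-⊖ (suc m) (suc n) = begin
      fromℤ (suc m ⊖ suc n)              ≡⟨ cong fromℤ (ℤ.[1+m]⊖[1+n]≡m⊖n m n) ⟩
      fromℤ (m ⊖ n)                      ≡⟨ fromℤ-⊖ m n ⟩
      m mod p - n mod p                  ≡⟨ sym (+-cancelˡ-- 1# (m mod p) (n mod p)) ⟩
      (1# + m mod p) - (1# + n mod p)    ≡⟨ sym (cong₂ _-_ (mod-distrib-+ 1 m) (mod-distrib-+ 1 n)) ⟩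
      suc m mod p - suc n mod p          ∎

    fromℤ-+ : ∀ i j → fromℤ (i ℤ.+ j) ≡ fromℤ i + fromℤ j
    fromℤ-+ (ℤ.+ m) (ℤ.+ n) = mod-distrib-+ m n
    fromℤ-+ (ℤ.+ m) -[1+ n ] = fromℤ-⊖ m (suc n)
    fromℤ-+ -[1+ m ] (ℤ.+ n) = trans (fromℤ-⊖ n (suc m)) (R.+-comm (n mod p) (- (suc m mod p)))
    fromℤ-+ -[1+ m ] -[1+ n ] = begin
      - (suc (suc (m ℕ.+ n)) mod p)        ≡⟨ cong (λ k → - (suc k mod p)) (sym (ℕ.+-suc m n)) ⟩
      - ((suc m ℕ.+ suc n) mod p)          ≡⟨ cong -_ (mod-distrib-+ (suc m) (suc n)) ⟩
      - (suc m mod p + suc n mod p)        ≡⟨ sym (⁻¹-∙-comm (suc m mod p) (suc n mod p)) ⟩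
      - (suc m mod p) + - (suc n mod p)    ∎

    fromℤ-neg : ∀ i → fromℤ (ℤ.- i) ≡ - fromℤ i
    fromℤ-neg (ℤ.+ zero) = sym ε⁻¹≈ε
    fromℤ-neg (ℤ.+ suc n) = refl
    fromℤ-neg -[1+ n ] = sym (⁻¹-involutive (suc n mod p))

    signed : Sign → Fin p
    signed Sign.+ = 1#
    signed Sign.- = - 1#

    signed-* : ∀ s t → signed (s Sign.* t) ≡ signed s * signed t
    signed-* Sign.+ t = sym (R.*-identityˡ (signed t))
    signed-* Sign.- Sign.+ = sym (R.*-identityʳ (- 1#))
    signed-* Sign.- Sign.- = sym (trans (-1*x≈-x (- 1#)) (⁻¹-involutive 1#))

    fromℤ-◃ : ∀ s n → fromℤ (s ◃ n) ≡ signed s * (n mod p)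
    fromℤ-◃ s zero = sym (R.zeroʳ (signed s))
    fromℤ-◃ Sign.+ (suc n) = sym (R.*-identityˡ (suc n mod p))
    fromℤ-◃ Sign.- (suc n) = sym (-1*x≈-x (suc n mod p))

    fromℤ-* : ∀ i j → fromℤ (i ℤ.* j) ≡ fromℤ i * fromℤ j
    fromℤ-* i j = begin
      fromℤ (sign i Sign.* sign j ◃ ∣ i ∣ ℕ.* ∣ j ∣)
        ≡⟨ fromℤ-◃ (sign i Sign.* sign j) (∣ i ∣ ℕ.* ∣ j ∣) ⟩
      signed (sign i Sign.* sign j) * (∣ i ∣ ℕ.* ∣ j ∣ mod p)
        ≡⟨ cong₂ _*_ (signed-* (sign i) (sign j)) (mod-distrib-* ∣ i ∣ ∣ j ∣) ⟩
      (signed (sign i) * signed (sign j)) * ((∣ i ∣ mod p) * (∣ j ∣ mod p))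
        ≡⟨ interchange _ _ _ _ ⟩
      (signed (sign i) * (∣ i ∣ mod p)) * (signed (sign j) * (∣ j ∣ mod p))
        ≡⟨ sym (cong₂ _*_ (fromℤ-◃ (sign i) ∣ i ∣) (fromℤ-◃ (sign j) ∣ j ∣)) ⟩
      fromℤ (sign i ◃ ∣ i ∣) * fromℤ (sign j ◃ ∣ j ∣)
        ≡⟨ cong₂ _*_ (cong fromℤ (ℤ.◃-inverse i)) (cong fromℤ (ℤ.◃-inverse j)) ⟩
      fromℤ i * fromℤ j ∎
      where open Algebra.Properties.CommutativeSemigroup R.*-commutativeSemigroup using (interchange)

  -- The ring solver needs coefficients whose arithmetic computes, which that of ℤₚ does not
  -- (p is a variable); so the coefficients are integers, interpreted in ℤₚ by fromℤ.
  ℤ⟶ℤₚ : ℤ.+-*-rawRing ACR.-Raw-AlmostCommutative⟶ ACR.fromCommutativeRing ℤₚ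
  ℤ⟶ℤₚ = record
    { ⟦_⟧ = fromℤ ; +-homo = fromℤ-+ ; *-homo = fromℤ-* ; -‿homo = fromℤ-neg ; 0-homo = refl ; 1-homo = refl }

  fromℤ-≟ : ∀ i j → Maybe (fromℤ i ≡ fromℤ j)
  fromℤ-≟ i j with i ℤ.≟ j
  ... | yes refl = just refl
  ... | no _ = nothing

  open Algebra.Solver.Ring ℤ.+-*-rawRing (ACR.fromCommutativeRing ℤₚ) ℤ⟶ℤₚ fromℤ-≟ public
    using (solve; _:=_; _:+_; _:*_; _:-_; :-_; con)

  toℕ-0# : toℕ 0# ≡ 0
  toℕ-0# = trans (toℕ-mod 0) (m<n⇒m%n≡m (ℕ.>-nonZero⁻¹ p))

  p∣toℕ⇒≡0# : ∀ {x} → p ∣ toℕ x → x ≡ 0#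
  p∣toℕ⇒≡0# {x} p∣x = Fin.toℕ-injective (trans (sym (m<n⇒m%n≡m (Fin.toℕ<n x))) (trans (n∣m⇒m%n≡0 _ p p∣x) (sym toℕ-0#)))

  x-y≡0#⇔x≡y : ∀ {x y} → x - y ≡ 0# ⇔ x ≡ y
  x-y≡0#⇔x≡y {x} {y} = mk⇔ (x∙y⁻¹≈ε⇒x≈y x y) x≈y⇒x∙y⁻¹≈ε

  ∑ ∏ : List (Fin p) → Fin p
  ∑ = foldr _+_ 0#
  ∏ = foldr _*_ 1#

  ∑-++ : ∀ xs ys → ∑ (xs ++ ys) ≡ ∑ xs + ∑ ys
  ∑-++ [] ys = sym (R.+-identityˡ (∑ ys))
  ∑-++ (x ∷ xs) ys = trans (cong (x +_) (∑-++ xs ys)) (sym (R.+-assoc x (∑ xs) (∑ ys)))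

  ∏-++ : ∀ xs ys → ∏ (xs ++ ys) ≡ ∏ xs * ∏ ys
  ∏-++ [] ys = sym (R.*-identityˡ (∏ ys))
  ∏-++ (x ∷ xs) ys = trans (cong (x *_) (∏-++ xs ys)) (sym (R.*-assoc x (∏ xs) (∏ ys)))

  ∑-map-++ : ∀ {A : Set} (w : A → Fin p) xs ys → ∑ (map w (xs ++ ys)) ≡ ∑ (map w xs) + ∑ (map w ys)
  ∑-map-++ w xs ys = trans (cong ∑ (List.map-++ w xs ys)) (∑-++ (map w xs) (map w ys))

  ∑-map-concatMap : ∀ {A B : Set} (w : B → Fin p) (h : A → List B) xs →
    ∑ (map w (concatMap h xs)) ≡ ∑ (map (λ x → ∑ (map w (h x))) xs)
  ∑-map-concatMap w h [] = refl
  ∑-map-concatMap w h (x ∷ xs) = trans (∑-map-++ w (h x) (concatMap h xs)) (cong (∑ (map w (h x)) +_) (∑-map-concatMap w h xs))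

  ∑-map-0# : ∀ {A : Set} (xs : List A) → ∑ (map (λ _ → 0#) xs) ≡ 0#
  ∑-map-0# [] = refl
  ∑-map-0# (x ∷ xs) = trans (cong (0# +_) (∑-map-0# xs)) (R.+-identityˡ 0#)

  *-distribˡ-∑-map : ∀ {A : Set} x (w : A → Fin p) ys → x * ∑ (map w ys) ≡ ∑ (map (λ y → x * w y) ys)
  *-distribˡ-∑-map x w [] = R.zeroʳ x
  *-distribˡ-∑-map x w (y ∷ ys) = trans (R.distribˡ x (w y) (∑ (map w ys))) (cong (x * w y +_) (*-distribˡ-∑-map x w ys))

  *-distribʳ-∑-map : ∀ {A : Set} x (w : A → Fin p) ys → ∑ (map w ys) * x ≡ ∑ (map (λ y → w y * x) ys)
  *-distribʳ-∑-map x w [] = R.zeroˡ x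
  *-distribʳ-∑-map x w (y ∷ ys) = trans (R.distribʳ x (w y) (∑ (map w ys))) (cong (w y * x +_) (*-distribʳ-∑-map x w ys))

  ∑-map-replicate : ∀ {A : Set} (w : A → Fin p) k x → ∑ (map w (replicate k x)) ≡ (k mod p) * w x
  ∑-map-replicate w zero x = sym (R.zeroˡ (w x))
  ∑-map-replicate w (suc k) x = begin
    w x + ∑ (map w (replicate k x))  ≡⟨ cong (w x +_) (∑-map-replicate w k x) ⟩
    w x + (k mod p) * w x            ≡⟨ cong (_+ (k mod p) * w x) (sym (R.*-identityˡ (w x))) ⟩
    1# * w x + (k mod p) * w x       ≡⟨ sym (R.distribʳ (w x) 1# (k mod p)) ⟩
    (1# + k mod p) * w x             ≡⟨ cong (_* w x) (sym (mod-distrib-+ 1 k)) ⟩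
    (suc k mod p) * w x              ∎
    where open ≡-Reasoning

  mod-sum : ∀ ns → sum ns mod p ≡ ∑ (map (_mod p) ns)
  mod-sum [] = refl
  mod-sum (n ∷ ns) = trans (mod-distrib-+ n (sum ns)) (cong (n mod p +_) (mod-sum ns))

  mod-product : ∀ ns → product ns mod p ≡ ∏ (map (_mod p) ns)
  mod-product [] = refl
  mod-product (n ∷ ns) = trans (mod-distrib-* n (product ns)) (cong ((n mod p) *_) (mod-product ns))

  ∑-allFin : ∀ {k} (f : Fin k → Fin p) → ∑ (map f (allFin k)) ≡ ∑[ i < k ] f i
  ∑-allFin {k} f = trans (cong ∑ (List.map-tabulate id f)) (∑-tabulate k f)
    where
    ∑-tabulate : ∀ k (f : Fin k → Fin p) → ∑ (tabulate f) ≡ ∑[ i < k ] f i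
    ∑-tabulate zero f = refl
    ∑-tabulate (suc k) f = cong (f fzero +_) (∑-tabulate k (f ∘ fsuc))

  ∑-single : ∀ {k} (f : Fin k → Fin p) i → (∀ j → j ≢ i → f j ≡ 0#) → ∑[ j < k ] f j ≡ f i
  ∑-single {suc k} f i off-i = begin
    ∑[ j < suc k ] f j                ≡⟨ sum-remove {i = i} f ⟩
    f i + ∑[ j < k ] f (punchIn i j)  ≡⟨ cong (f i +_) (sum-cong-≗ (λ j → off-i _ (Fin.punchInᵢ≢i i j))) ⟩
    f i + ∑[ j < k ] 0#               ≡⟨ cong (f i +_) (sum-replicate-zero k) ⟩
    f i + 0#                          ≡⟨ R.+-identityʳ (f i) ⟩
    f i                               ∎
    where open ≡-Reasoning

  vanishing : (Fin p → Bool) → List (Fin p)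
  vanishing P = filterᵇ (not ∘ P) (allFin p)

  indicator : (Fin p → Bool) → Fin p → Fin p
  indicator P x = ∏ (map (λ s → x - s) (vanishing P))

  module Field (p-prime : Prime p) where

    1#≢0# : 1# ≢ 0#
    1#≢0# 1≡0 = ℕ.1+n≢0 (trans (sym (trans (toℕ-mod 1) (m<n⇒m%n≡m 1<p))) (trans (cong toℕ 1≡0) toℕ-0#))
      where 1<p = nonTrivial⇒n>1 p {{prime⇒nonTrivial p-prime}}

    *-integral : ∀ x y → x * y ≡ 0# → x ≡ 0# ⊎ y ≡ 0#
    *-integral x y xy≡0 = Sum.map p∣toℕ⇒≡0# p∣toℕ⇒≡0#
      (euclidsLemma (toℕ x) (toℕ y) p-prime (m%n≡0⇒n∣m _ p (trans (sym (toℕ-* x y)) (trans (cong toℕ xy≡0) toℕ-0#))))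

    ∏-sub≡0#⇔∈ : ∀ x ss → ∏ (map (λ s → x - s) ss) ≡ 0# ⇔ x ∈ ss
    ∏-sub≡0#⇔∈ x [] = mk⇔ (λ 1≡0 → contradiction 1≡0 1#≢0#) λ ()
    ∏-sub≡0#⇔∈ x (s ∷ ss) = mk⇔
      (λ e → Sum.[ here ∘ Equivalence.to x-y≡0#⇔x≡y , there ∘ Equivalence.to (∏-sub≡0#⇔∈ x ss) ] (*-integral _ _ e))
      λ { (here x≡s) → trans (cong (_* _) (Equivalence.from x-y≡0#⇔x≡y x≡s)) (R.zeroˡ _)
        ; (there x∈ss) → trans (cong (_ *_) (Equivalence.from (∏-sub≡0#⇔∈ x ss) x∈ss)) (R.zeroʳ _) }

    indicator≡0#⇔ : ∀ P x → indicator P x ≡ 0# ⇔ T (not (P x))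
    indicator≡0#⇔ P x = mk⇔
      (λ e → proj₂ (∈-filter⁻ (T? ∘ not ∘ P) {xs = allFin p} (Equivalence.to (∏-sub≡0#⇔∈ x (vanishing P)) e)))
      (λ t → Equivalence.from (∏-sub≡0#⇔∈ x (vanishing P)) (∈-filter⁺ (T? ∘ not ∘ P) (∈-allFin x) t))

    indicator≢0#⇔ : ∀ P x → indicator P x ≢ 0# ⇔ T (P x)
    indicator≢0#⇔ P x with P x in Px
    ... | true = mk⇔ (λ _ → tt) (λ _ e → subst (T ∘ not) Px (Equivalence.to (indicator≡0#⇔ P x) e))
    ... | false = mk⇔ (λ ≢0 → ≢0 (Equivalence.from (indicator≡0#⇔ P x) (subst (T ∘ not) (sym Px) tt))) λ ()

    -- Only the summand β = z survives, and there the first factor is nonzero.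
    interpolation : ∀ (S : Fin p → Fin p → Bool) a z →
      ∑[ β < p ] (indicator (λ s → does (s ≟ β)) z * indicator (λ s → S s β) a) ≢ 0# ⇔ T (S a z)
    interpolation S a z = mk⇔
      (λ ∑≢0 → Equivalence.to (indicator≢0#⇔ _ a) λ e → ∑≢0 (trans ∑≡term (trans (cong (_ *_) e) (R.zeroʳ _))))
      (λ Saz ∑≡0 → Sum.[ Equivalence.from (indicator≢0#⇔ _ z) (subst T (sym (dec-true (z ≟ z) refl)) tt)
                       , Equivalence.from (indicator≢0#⇔ _ a) Saz ]
                       (*-integral _ _ (trans (sym ∑≡term) ∑≡0)))
      where
      ∑≡term : ∑[ β < p ] (indicator (λ s → does (s ≟ β)) z * indicator (λ s → S s β) a)
             ≡ indicator (λ s → does (s ≟ z)) z * indicator (λ s → S s z) a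
      ∑≡term = ∑-single _ z λ β β≢z → trans
        (cong (_* _) (Equivalence.from (indicator≡0#⇔ _ z) (subst (T ∘ not) (sym (dec-false (z ≟ β) (β≢z ∘ sym))) tt)))
        (R.zeroˡ _)

-- Commutators

-- Without function extensionality, that _≡_ is a congruence is a property of the algebra.
module Commutators (A : FiniteAlgebra) (≡-compatible : IsCongruence A _≡_) where
  open FiniteAlgebra A

  term-compatible : ∀ {θ : Rel A} → IsCongruence A θ → ∀ {X : Set} (t : Term A X) {ρ σ : X → Fin size} →
                    (∀ x → θ (ρ x) (σ x)) → θ (eval A t ρ) (eval A t σ)
  term-compatible θ-cong (var x) ρθσ = ρθσ x
  term-compatible θ-cong (app f ts) ρθσ = IsCongruence.compat θ-cong f _ _ λ i → term-compatible θ-cong (ts i) ρθσ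

  eval-cong : ∀ {X : Set} (t : Term A X) {ρ σ : X → Fin size} → (∀ x → ρ x ≡ σ x) → eval A t ρ ≡ eval A t σ
  eval-cong = term-compatible ≡-compatible

  TC-≡ : TC A _≡_ _≡_ _≡_
  TC-≡ k l t a b c e a≡b c≡e tac≡tae = trans (eval-cong t b,c≡a,c) (trans tac≡tae (eval-cong t a,e≡b,e))
    where
    b,c≡a,c : ∀ i → [ b , c ] i ≡ [ a , c ] i
    b,c≡a,c (inj₁ i) = sym (a≡b i)
    b,c≡a,c (inj₂ j) = refl
    a,e≡b,e : ∀ i → [ a , e ] i ≡ [ b , e ] i
    a,e≡b,e (inj₁ i) = a≡b i
    a,e≡b,e (inj₂ j) = refl

  IsCommutator-≡ : ∀ {α β : Rel A} → TC A α β _≡_ → IsCommutator A α β _≡_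
  IsCommutator-≡ tc = ≡-compatible , tc , λ { δ δ-cong _ x .x refl → IsCongruence.refl′ δ-cong x }

  malcevOp : Malcev A → Fin size → Fin size → Fin size → Fin size
  malcevOp (m , _) x y z = eval A m (lookup (x ∷ y ∷ z ∷ []))

  -- With m the Malcev operation, t(b,c) = t(m((a,c),(a,e),(b,e))) δ m(t(a,c), t(a,e), t(b,e))
  -- δ m(t(a,e), t(a,e), t(b,e)) = t(b,e).
  TC-by-commuting : ∀ {α β δ : Rel A} (mal : Malcev A) → IsCongruence A δ →
    (∀ {k l} (t : Term A (Fin k ⊎ Fin l)) (a b : Fin k → Fin size) (c e : Fin l → Fin size) →
      (∀ i → α (a i) (b i)) → (∀ j → β (c j) (e j)) →
      δ (eval A t (λ i → malcevOp mal ([ a , c ] i) ([ a , e ] i) ([ b , e ] i)))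
        (malcevOp mal (eval A t [ a , c ]) (eval A t [ a , e ]) (eval A t [ b , e ]))) →
    TC A α β δ
  TC-by-commuting {δ = δ} (m , m-identities) δ-cong commutes k l t a b c e αab βce tac-δ-tae =
    subst₂ δ (sym (eval-cong t b,c≡M)) (proj₂ (m-identities tbe tae))
      (trans′ (commutes t a b c e αab βce)
        (term-compatible δ-cong m λ { 0F → tac-δ-tae ; 1F → refl′ tae ; 2F → refl′ tbe }))
    where
    open IsCongruence δ-cong
    tac = eval A t [ a , c ]
    tae = eval A t [ a , e ]
    tbe = eval A t [ b , e ]
    b,c≡M : ∀ i → [ b , c ] i ≡ eval A m (lookup ([ a , c ] i ∷ [ a , e ] i ∷ [ b , e ] i ∷ []))
    b,c≡M (inj₁ i) = sym (proj₂ (m-identities (b i) (a i)))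
    b,c≡M (inj₂ j) = sym (proj₁ (m-identities (c j) (e j)))

-- The algebra

module PairAlgebra (p : ℕ) .{{_ : NonZero p}} where
  open IntegersModulo p
  private module R = CommutativeRing ℤₚ

  mal : Fin p → Fin p → Fin p → Fin p
  mal a b c = a - b + c

  mal-cancelʳ : ∀ a b → mal a b b ≡ a
  mal-cancelʳ = solve 2 (λ a b → a :- b :+ b := a) refl

  mal-cancelˡ : ∀ a b → mal b b a ≡ a
  mal-cancelˡ = solve 2 (λ a b → b :- b :+ a := a) refl

  mal-medial : ∀ u₀ v₀ w₀ u₁ v₁ w₁ u₂ v₂ w₂ →
    mal (mal u₀ v₀ w₀) (mal u₁ v₁ w₁) (mal u₂ v₂ w₂) ≡ mal (mal u₀ u₁ u₂) (mal v₀ v₁ v₂) (mal w₀ w₁ w₂)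
  mal-medial = solve 9 (λ u₀ v₀ w₀ u₁ v₁ w₁ u₂ v₂ w₂ →
    (u₀ :- v₀ :+ w₀) :- (u₁ :- v₁ :+ w₁) :+ (u₂ :- v₂ :+ w₂)
      := (u₀ :- u₁ :+ u₂) :- (v₀ :- v₁ :+ v₂) :+ (w₀ :- w₁ :+ w₂)) refl

  mal-affine : ∀ u₀ v₀ w₀ u₁ v₁ w₁ z →
    mal u₀ v₀ w₀ + mal u₁ v₁ w₁ * z ≡ mal (u₀ + u₁ * z) (v₀ + v₁ * z) (w₀ + w₁ * z)
  mal-affine = solve 7 (λ u₀ v₀ w₀ u₁ v₁ w₁ z →
    (u₀ :- v₀ :+ w₀) :+ (u₁ :- v₁ :+ w₁) :* z := (u₀ :+ u₁ :* z) :- (v₀ :+ v₁ :* z) :+ (w₀ :+ w₁ :* z)) refl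

  mal-+ : ∀ a b c a′ b′ c′ → mal a b c + mal a′ b′ c′ ≡ mal (a + a′) (b + b′) (c + c′)
  mal-+ = solve 6 (λ a b c a′ b′ c′ → (a :- b :+ c) :+ (a′ :- b′ :+ c′) := (a :+ a′) :- (b :+ b′) :+ (c :+ c′)) refl

  mal-*ʳ : ∀ a b c x → mal a b c * x ≡ mal (a * x) (b * x) (c * x)
  mal-*ʳ = solve 4 (λ a b c x → (a :- b :+ c) :* x := (a :* x) :- (b :* x) :+ (c :* x)) refl

  mal-0# : mal 0# 0# 0# ≡ 0#
  mal-0# = mal-cancelʳ 0# 0#

  E : Set
  E = Fin (p ℕ.* p)

  ⟨_,_⟩ : Fin p → Fin p → E
  ⟨ a , z ⟩ = combine {p} {p} a z

  π₁ π₂ : E → Fin p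
  π₁ x = proj₁ (remQuot {p} p x)
  π₂ x = proj₂ (remQuot {p} p x)

  π₁-⟨⟩ : ∀ a z → π₁ ⟨ a , z ⟩ ≡ a
  π₁-⟨⟩ a z = cong proj₁ (Fin.remQuot-combine {p} {p} a z)

  π₂-⟨⟩ : ∀ a z → π₂ ⟨ a , z ⟩ ≡ z
  π₂-⟨⟩ a z = cong proj₂ (Fin.remQuot-combine {p} {p} a z)

  ⟨π₁,π₂⟩ : ∀ x → ⟨ π₁ x , π₂ x ⟩ ≡ x
  ⟨π₁,π₂⟩ x = Fin.combine-remQuot {p} p x

  ≡-by-π : ∀ {x y} → π₁ x ≡ π₁ y → π₂ x ≡ π₂ y → x ≡ y
  ≡-by-π {x} {y} e₁ e₂ = trans (sym (⟨π₁,π₂⟩ x)) (trans (cong₂ ⟨_,_⟩ e₁ e₂) (⟨π₁,π₂⟩ y))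

  d f : E → E → E → E
  d x y z = ⟨ mal (π₁ x) (π₁ y) (π₁ z) , mal (π₂ x) (π₂ y) (π₂ z) ⟩
  f x y z = ⟨ π₁ x + π₁ y * π₂ z , 0# ⟩

  operation : Fin 2 → (Fin 3 → E) → E
  operation 0F a = d (a 0F) (a 1F) (a 2F)
  operation 1F a = f (a 0F) (a 1F) (a 2F)

  𝔸 : FiniteAlgebra
  𝔸 = record { size = p ℕ.* p ; nops = 2 ; arity = λ _ → 3 ; op = operation }

  π₁-d : ∀ x y z → π₁ (d x y z) ≡ mal (π₁ x) (π₁ y) (π₁ z)
  π₁-d x y z = π₁-⟨⟩ _ _

  π₂-d : ∀ x y z → π₂ (d x y z) ≡ mal (π₂ x) (π₂ y) (π₂ z)
  π₂-d x y z = π₂-⟨⟩ _ _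

  π₁-f : ∀ x y z → π₁ (f x y z) ≡ π₁ x + π₁ y * π₂ z
  π₁-f x y z = π₁-⟨⟩ _ _

  π₂-f : ∀ x y z → π₂ (f x y z) ≡ 0#
  π₂-f x y z = π₂-⟨⟩ _ _

  d-cancelʳ : ∀ x y → d x y y ≡ x
  d-cancelʳ x y = ≡-by-π (trans (π₁-d x y y) (mal-cancelʳ (π₁ x) (π₁ y))) (trans (π₂-d x y y) (mal-cancelʳ (π₂ x) (π₂ y)))

  d-cancelˡ : ∀ x y → d y y x ≡ x
  d-cancelˡ x y = ≡-by-π (trans (π₁-d y y x) (mal-cancelˡ (π₁ x) (π₁ y))) (trans (π₂-d y y x) (mal-cancelˡ (π₂ x) (π₂ y)))

  malcev : Malcev 𝔸
  malcev = app 0F var , λ x y → d-cancelʳ x y , d-cancelˡ x y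

  d-medial : ∀ u₀ v₀ w₀ u₁ v₁ w₁ u₂ v₂ w₂ →
    d (d u₀ v₀ w₀) (d u₁ v₁ w₁) (d u₂ v₂ w₂) ≡ d (d u₀ u₁ u₂) (d v₀ v₁ v₂) (d w₀ w₁ w₂)
  d-medial u₀ v₀ w₀ u₁ v₁ w₁ u₂ v₂ w₂ = ≡-by-π (medial-at π₁ π₁-d) (medial-at π₂ π₂-d)
    where
    medial-at : (π : E → Fin p) → (∀ x y z → π (d x y z) ≡ mal (π x) (π y) (π z)) →
      π (d (d u₀ v₀ w₀) (d u₁ v₁ w₁) (d u₂ v₂ w₂)) ≡ π (d (d u₀ u₁ u₂) (d v₀ v₁ v₂) (d w₀ w₁ w₂))
    medial-at π π-d = begin
      π (d (d u₀ v₀ w₀) (d u₁ v₁ w₁) (d u₂ v₂ w₂))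
        ≡⟨ trans (π-d _ _ _) (cong₃ mal (π-d u₀ v₀ w₀) (π-d u₁ v₁ w₁) (π-d u₂ v₂ w₂)) ⟩
      mal (mal (π u₀) (π v₀) (π w₀)) (mal (π u₁) (π v₁) (π w₁)) (mal (π u₂) (π v₂) (π w₂))
        ≡⟨ mal-medial _ _ _ _ _ _ _ _ _ ⟩
      mal (mal (π u₀) (π u₁) (π u₂)) (mal (π v₀) (π v₁) (π v₂)) (mal (π w₀) (π w₁) (π w₂))
        ≡⟨ sym (trans (π-d _ _ _) (cong₃ mal (π-d u₀ u₁ u₂) (π-d v₀ v₁ v₂) (π-d w₀ w₁ w₂))) ⟩
      π (d (d u₀ u₁ u₂) (d v₀ v₁ v₂) (d w₀ w₁ w₂)) ∎
      where open ≡-Reasoning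

  ≡-compatible : IsCongruence 𝔸 _≡_
  ≡-compatible = record { refl′ = λ _ → refl ; sym′ = sym ; trans′ = trans ; compat = compat }
    where
    compat : ∀ g (a b : Fin 3 → E) → (∀ i → a i ≡ b i) → operation g a ≡ operation g b
    compat 0F a b a≡b = cong₃ d (a≡b 0F) (a≡b 1F) (a≡b 2F)
    compat 1F a b a≡b = cong₃ f (a≡b 0F) (a≡b 1F) (a≡b 2F)

  open Commutators 𝔸 ≡-compatible

  θ₁ : Rel 𝔸
  θ₁ x y = π₂ x ≡ π₂ y

  total : Rel 𝔸
  total _ _ = ⊤

  θ₁-isCongruence : IsCongruence 𝔸 θ₁
  θ₁-isCongruence = record { refl′ = λ _ → refl ; sym′ = sym ; trans′ = trans ; compat = compat }
    where
    compat : ∀ g (a b : Fin 3 → E) → (∀ i → θ₁ (a i) (b i)) → θ₁ (operation g a) (operation g b)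
    compat 0F a b ab = trans (π₂-d _ _ _) (trans (cong₃ mal (ab 0F) (ab 1F) (ab 2F)) (sym (π₂-d _ _ _)))
    compat 1F a b ab = trans (π₂-f _ _ _) (sym (π₂-f _ _ _))

  π₂-operation-d : ∀ g (u v w : Fin 3 → E) →
    θ₁ (operation g (λ i → d (u i) (v i) (w i))) (d (operation g u) (operation g v) (operation g w))
  π₂-operation-d 0F u v w = cong π₂ (d-medial _ _ _ _ _ _ _ _ _)
  π₂-operation-d 1F u v w = trans (π₂-f _ _ _)
    (sym (trans (π₂-d _ _ _) (trans (cong₃ mal (π₂-f _ _ _) (π₂-f _ _ _) (π₂-f _ _ _)) mal-0#)))

  operation-d-on-θ₁ : ∀ g (u v w : Fin 3 → E) → (∀ i → θ₁ (u i) (v i)) → (∀ i → θ₁ (v i) (w i)) →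
    operation g (λ i → d (u i) (v i) (w i)) ≡ d (operation g u) (operation g v) (operation g w)
  operation-d-on-θ₁ 0F u v w _ _ = d-medial _ _ _ _ _ _ _ _ _
  operation-d-on-θ₁ 1F u v w uv vw = ≡-by-π π₁-part (π₂-operation-d 1F u v w)
    where
    open ≡-Reasoning
    z = π₂ (w 2F)
    π₂u₂≡z : π₂ (u 2F) ≡ z
    π₂u₂≡z = trans (uv 2F) (vw 2F)
    π₁-part : π₁ (f (d (u 0F) (v 0F) (w 0F)) (d (u 1F) (v 1F) (w 1F)) (d (u 2F) (v 2F) (w 2F)))
            ≡ π₁ (d (f (u 0F) (u 1F) (u 2F)) (f (v 0F) (v 1F) (v 2F)) (f (w 0F) (w 1F) (w 2F)))
    π₁-part = begin
      π₁ (f (d (u 0F) (v 0F) (w 0F)) (d (u 1F) (v 1F) (w 1F)) (d (u 2F) (v 2F) (w 2F)))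
        ≡⟨ π₁-f _ _ _ ⟩
      π₁ (d (u 0F) (v 0F) (w 0F)) + π₁ (d (u 1F) (v 1F) (w 1F)) * π₂ (d (u 2F) (v 2F) (w 2F))
        ≡⟨ cong₃ (λ a b c → a + b * c) (π₁-d _ _ _) (π₁-d _ _ _)
             (trans (π₂-d _ _ _) (trans (cong₂ (λ a b → mal a b z) π₂u₂≡z (vw 2F)) (mal-cancelʳ z z))) ⟩
      mal (π₁ (u 0F)) (π₁ (v 0F)) (π₁ (w 0F)) + mal (π₁ (u 1F)) (π₁ (v 1F)) (π₁ (w 1F)) * z
        ≡⟨ mal-affine _ _ _ _ _ _ z ⟩
      mal (π₁ (u 0F) + π₁ (u 1F) * z) (π₁ (v 0F) + π₁ (v 1F) * z) (π₁ (w 0F) + π₁ (w 1F) * z)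
        ≡⟨ sym (trans (π₁-d _ _ _) (cong₃ mal (trans (π₁-f _ _ _) (cong (λ c → _ + _ * c) π₂u₂≡z))
                                                (trans (π₁-f _ _ _) (cong (λ c → _ + _ * c) (vw 2F)))
                                                (π₁-f _ _ _))) ⟩
      π₁ (d (f (u 0F) (u 1F) (u 2F)) (f (v 0F) (v 1F) (v 2F)) (f (w 0F) (w 1F) (w 2F))) ∎

  π₂-eval-d : ∀ {X : Set} (t : Term 𝔸 X) (ρ σ τ : X → E) →
    θ₁ (eval 𝔸 t (λ x → d (ρ x) (σ x) (τ x))) (d (eval 𝔸 t ρ) (eval 𝔸 t σ) (eval 𝔸 t τ))
  π₂-eval-d (var x) ρ σ τ = refl
  π₂-eval-d (app g ts) ρ σ τ = trans
    (IsCongruence.compat θ₁-isCongruence g _ _ λ i → π₂-eval-d (ts i) ρ σ τ)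
    (π₂-operation-d g (λ i → eval 𝔸 (ts i) ρ) (λ i → eval 𝔸 (ts i) σ) (λ i → eval 𝔸 (ts i) τ))

  eval-d-on-θ₁ : ∀ {X : Set} (t : Term 𝔸 X) (ρ σ τ : X → E) →
    (∀ x → θ₁ (ρ x) (σ x)) → (∀ x → θ₁ (σ x) (τ x)) →
    eval 𝔸 t (λ x → d (ρ x) (σ x) (τ x)) ≡ d (eval 𝔸 t ρ) (eval 𝔸 t σ) (eval 𝔸 t τ)
  eval-d-on-θ₁ (var x) ρ σ τ _ _ = refl
  eval-d-on-θ₁ (app g ts) ρ σ τ ρσ στ = trans
    (IsCongruence.compat ≡-compatible g _ _ λ i → eval-d-on-θ₁ (ts i) ρ σ τ ρσ στ)
    (operation-d-on-θ₁ g _ _ _ (λ i → term-compatible θ₁-isCongruence (ts i) ρσ)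
                               (λ i → term-compatible θ₁-isCongruence (ts i) στ))

  TC-total-θ₁ : TC 𝔸 total total θ₁
  TC-total-θ₁ = TC-by-commuting {α = total} {β = total} malcev θ₁-isCongruence λ t a b c e _ _ →
    π₂-eval-d t [ a , c ] [ a , e ] [ b , e ]

  TC-θ₁-≡ : TC 𝔸 θ₁ θ₁ _≡_
  TC-θ₁-≡ = TC-by-commuting {α = θ₁} {β = θ₁} malcev ≡-compatible λ t a b c e θ₁ab θ₁ce →
    eval-d-on-θ₁ t [ a , c ] [ a , e ] [ b , e ] [ (λ _ → refl) , θ₁ce ] [ θ₁ab , (λ _ → refl) ]

  θ₁-least : ∀ δ → IsCongruence 𝔸 δ → TC 𝔸 total total δ → ∀ x y → θ₁ x y → δ x y
  θ₁-least δ δ-cong tc x y π₂x≡π₂y =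
    trans′ (δ-to-axis x) (subst (λ z → δ ⟨ 0# , z ⟩ y) (sym π₂x≡π₂y) (sym′ (δ-to-axis y)))
    where
    open IsCongruence δ-cong

    O : E
    O = ⟨ 0# , 0# ⟩

    probe : Term 𝔸 (Fin 1 ⊎ Fin 1)
    probe = app 1F λ { 0F → var (inj₂ 0F) ; 1F → var (inj₁ 0F) ; 2F → var (inj₂ 0F) }

    probe-value : ∀ α c → eval 𝔸 probe [ (λ _ → ⟨ α , 0# ⟩) , (λ _ → ⟨ 0# , c ⟩) ] ≡ ⟨ α * c , 0# ⟩
    probe-value α c = cong (λ a → ⟨ a , 0# ⟩)
      (trans (cong₂ _+_ (π₁-⟨⟩ 0# c) (cong₂ _*_ (π₁-⟨⟩ α 0#) (π₂-⟨⟩ 0# c))) (R.+-identityˡ (α * c)))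

    -- probe(a, c) = f(c, a, c) is (α γ , 0) at a = (α , 0), c = (0 , γ). At a = O both c = O and
    -- c = (0 , 1) give O, so the term condition relates the values O and (α , 0) at a = (α , 0).
    O-δ-axis : ∀ α → δ O ⟨ α , 0# ⟩
    O-δ-axis α = subst₂ δ (trans (probe-value α 0#) (cong (λ a → ⟨ a , 0# ⟩) (R.zeroʳ α)))
                          (trans (probe-value α 1#) (cong (λ a → ⟨ a , 0# ⟩) (R.*-identityʳ α)))
      (tc 1 1 probe (λ _ → O) (λ _ → ⟨ α , 0# ⟩) (λ _ → O) (λ _ → ⟨ 0# , 1# ⟩) _ _
        (subst₂ δ (sym (trans (probe-value 0# 0#) (cong (λ a → ⟨ a , 0# ⟩) (R.zeroʳ 0#))))
                  (sym (trans (probe-value 0# 1#) (cong (λ a → ⟨ a , 0# ⟩) (R.zeroˡ 1#))))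
                  (refl′ O)))

    δ-to-axis : ∀ x → δ x ⟨ 0# , π₂ x ⟩
    δ-to-axis x = subst₂ δ split (d-cancelˡ ⟨ 0# , π₂ x ⟩ O)
      (compat 0F (λ { 0F → ⟨ π₁ x , 0# ⟩ ; 1F → O ; 2F → ⟨ 0# , π₂ x ⟩ })
                 (λ { 0F → O ; 1F → O ; 2F → ⟨ 0# , π₂ x ⟩ })
                 (λ { 0F → sym′ (O-δ-axis (π₁ x)) ; 1F → refl′ O ; 2F → refl′ _ }))
      where
      split : d ⟨ π₁ x , 0# ⟩ O ⟨ 0# , π₂ x ⟩ ≡ x
      split = ≡-by-π
        (trans (π₁-d _ _ _) (trans (cong₃ mal (π₁-⟨⟩ _ _) (π₁-⟨⟩ _ _) (π₁-⟨⟩ _ _)) (mal-cancelʳ (π₁ x) 0#)))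
        (trans (π₂-d _ _ _) (trans (cong₃ mal (π₂-⟨⟩ _ _) (π₂-⟨⟩ _ _) (π₂-⟨⟩ _ _)) (mal-cancelˡ (π₂ x) 0#)))

  derived : ℕ → Rel 𝔸
  derived 0 = total
  derived 1 = θ₁
  derived (suc (suc _)) = _≡_

  derived-commutator : ∀ i → IsCommutator 𝔸 (derived i) (derived i) (derived (suc i))
  derived-commutator 0 = θ₁-isCongruence , TC-total-θ₁ , θ₁-least
  derived-commutator 1 = IsCommutator-≡ {θ₁} {θ₁} TC-θ₁-≡
  derived-commutator (suc (suc _)) = IsCommutator-≡ {_≡_} {_≡_} TC-≡

  solvable : Solvable 𝔸
  solvable = 2 , derived , (λ _ _ → tt) , derived-commutator , λ _ _ x≡y → x≡y

-- Algebraic branching programs as linear programs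

module LinearPrograms (p : ℕ) .{{_ : NonZero p}} where
  open IntegersModulo p
  private module R = CommutativeRing ℤₚ

  ⟦_⟧ : ∀ {n} → Label p n → Vec Bool n → Fin p
  ⟦ ℓ ⟧ b = labelVal b ℓ mod p

  weight : ∀ {n} → Vec Bool n → List (Label p n) → Fin p
  weight b π = ∏ (map (λ ℓ → ⟦ ℓ ⟧ b) π)

  pathSum : ∀ {n} → Vec Bool n → List (List (Label p n)) → Fin p
  pathSum b πs = ∑ (map (weight b) πs)

  abpEval≡pathSum : ∀ {n} (g : ABP p n) b → abpEval g b ≡ pathSum b (ABP.allPaths g)
  abpEval≡pathSum g b = begin
    sum (map (λ π → product (map (labelVal b) π)) πs) mod p
      ≡⟨ mod-sum (map (λ π → product (map (labelVal b) π)) πs) ⟩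
    ∑ (map (_mod p) (map (λ π → product (map (labelVal b) π)) πs))
      ≡⟨ cong ∑ (sym (List.map-∘ πs)) ⟩
    ∑ (map (λ π → product (map (labelVal b) π) mod p) πs)
      ≡⟨ cong ∑ (List.map-cong (λ π → trans (mod-product (map (labelVal b) π)) (cong ∏ (sym (List.map-∘ π)))) πs) ⟩
    pathSum b πs ∎
    where
    open ≡-Reasoning
    πs = ABP.allPaths g

  pathSum-cons : ∀ {n} b (ℓ : Label p n) πs → pathSum b (map (ℓ ∷_) πs) ≡ ⟦ ℓ ⟧ b * pathSum b πs
  pathSum-cons b ℓ πs = trans (cong ∑ (sym (List.map-∘ πs))) (sym (*-distribˡ-∑-map (⟦ ℓ ⟧ b) (weight b) πs))

  Node : ℕ → ℕ → Set
  Node n m = List (Label p n × Fin (suc m))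

  -- Node 0 is the root and node m of a `Program n m` is the sink; terms point to later nodes.
  infixr 5 _◁_
  data Program (n : ℕ) : ℕ → Set where
    end : Program n 0
    _◁_ : ∀ {m} → Node n m → Program n m → Program n (suc m)

  nodeValue : ∀ {n m} → Vec Bool n → (Fin (suc m) → Fin p) → Node n m → Fin p
  nodeValue b V x = ∑ (map (λ (ℓ , t) → ⟦ ℓ ⟧ b * V t) x)

  value : ∀ {n m} → Program n m → Vec Bool n → Fin (suc m) → Fin p
  value end b _ = 1#
  value (x ◁ P) b fzero = nodeValue b (value P b) x
  value (x ◁ P) b (fsuc u) = value P b u

  value-sink : ∀ {n m} (P : Program n m) b → value P b (fromℕ m) ≡ 1#
  value-sink end b = refl
  value-sink (x ◁ P) b = value-sink P b

  -- By definition, `paths (suc f) u` is `atSink u ++ concatMap (step f u) edges`.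
  module _ {n : ℕ} (g : ABP p n) where
    open ABP g

    atSink : Fin (suc v) → List (List (Label p n))
    atSink u = if does (u ≟ sink) then [] ∷ [] else []

    step : ℕ → Fin (suc v) → Edge p n (suc v) → List (List (Label p n))
    step f u e = if does (Edge.from e ≟ u) then map (Edge.label e ∷_) (paths f (Edge.to e)) else []


  shiftEdge : ∀ {n V} → Edge p n (suc V) → Edge p n (suc (suc V))
  shiftEdge e = record { from = fsuc (Edge.from e) ; to = fsuc (Edge.to e) ; label = Edge.label e }

  rootEdge : ∀ {n m} → Label p n × Fin (suc m) → Edge p n (suc (suc m))
  rootEdge (ℓ , t) = record { from = fzero ; to = fsuc t ; label = ℓ }

  edgesOf : ∀ {n m} → Program n m → List (Edge p n (suc m))
  edgesOf end = []
  edgesOf (x ◁ P) = map shiftEdge (edgesOf P) ++ map rootEdge x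

  edgesOf-dag : ∀ {n m} (P : Program n m) → All (λ e → toℕ (Edge.from e) < toℕ (Edge.to e)) (edgesOf P)
  edgesOf-dag end = []
  edgesOf-dag (x ◁ P) = All.++⁺ (All.map⁺ (All.map s≤s (edgesOf-dag P))) (All.map⁺ (All.universal (λ _ → s≤s z≤n) x))

  toABP : ∀ {n m} → Program n m → ABP p n
  toABP {m = m} P = record { v = m ; edges = edgesOf P ; dag = edgesOf-dag P }

  paths-◁ : ∀ {n m} (x : Node n m) (P : Program n m) f u →
            ABP.paths (toABP (x ◁ P)) f (fsuc u) ≡ ABP.paths (toABP P) f u
  paths-◁ x P zero u = refl
  paths-◁ x P (suc f) u = cong (atSink (toABP P) u ++_) (begin
    concatMap (step G f (fsuc u)) (map shiftEdge (edgesOf P) ++ map rootEdge x)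
      ≡⟨ List.concatMap-++ (step G f (fsuc u)) (map shiftEdge (edgesOf P)) (map rootEdge x) ⟩
    concatMap (step G f (fsuc u)) (map shiftEdge (edgesOf P)) ++ concatMap (step G f (fsuc u)) (map rootEdge x)
      ≡⟨ cong₂ _++_ (trans (List.concatMap-map _ shiftEdge (edgesOf P)) (List.concatMap-cong shifted (edgesOf P)))
                    (trans (List.concatMap-map _ rootEdge x) (concatMap-[] x)) ⟩
    concatMap (step (toABP P) f u) (edgesOf P) ++ []
      ≡⟨ List.++-identityʳ _ ⟩
    concatMap (step (toABP P) f u) (edgesOf P) ∎)
    where
    open ≡-Reasoning
    G = toABP (x ◁ P)
    shifted : ∀ e → step G f (fsuc u) (shiftEdge e) ≡ step (toABP P) f u e
    shifted e = cong (λ πs → if does (Edge.from e ≟ u) then map (Edge.label e ∷_) πs else []) (paths-◁ x P f (Edge.to e))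

  paths-root : ∀ {n m} (x : Node n m) (P : Program n m) f →
    ABP.paths (toABP (x ◁ P)) (suc f) fzero ≡ concatMap (λ (ℓ , t) → map (ℓ ∷_) (ABP.paths (toABP P) f t)) x
  paths-root x P f = begin
    concatMap (step G f fzero) (map shiftEdge (edgesOf P) ++ map rootEdge x)
      ≡⟨ List.concatMap-++ (step G f fzero) (map shiftEdge (edgesOf P)) (map rootEdge x) ⟩
    concatMap (step G f fzero) (map shiftEdge (edgesOf P)) ++ concatMap (step G f fzero) (map rootEdge x)
      ≡⟨ cong₂ _++_ (trans (List.concatMap-map _ shiftEdge (edgesOf P)) (concatMap-[] (edgesOf P)))
                    (trans (List.concatMap-map _ rootEdge x) (List.concatMap-cong (λ (ℓ , t) → cong (map (ℓ ∷_)) (paths-◁ x P f t)) x)) ⟩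
    concatMap (λ (ℓ , t) → map (ℓ ∷_) (ABP.paths (toABP P) f t)) x ∎
    where
    open ≡-Reasoning
    G = toABP (x ◁ P)

  pathSum-toABP : ∀ {n m} (P : Program n m) b f u → m ≤ toℕ u ℕ.+ f →
                  pathSum b (ABP.paths (toABP P) f u) ≡ value P b u
  pathSum-toABP end b zero fzero _ = R.+-identityʳ 1#
  pathSum-toABP end b (suc f) fzero _ = R.+-identityʳ 1#
  pathSum-toABP (x ◁ P) b f (fsuc u) (s≤s m≤u+f) =
    trans (cong (pathSum b) (paths-◁ x P f u)) (pathSum-toABP P b f u m≤u+f)
  pathSum-toABP (x ◁ P) b (suc f) fzero (s≤s m≤f) = begin
    pathSum b (ABP.paths (toABP (x ◁ P)) (suc f) fzero)
      ≡⟨ cong (pathSum b) (paths-root x P f) ⟩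
    pathSum b (concatMap (λ (ℓ , t) → map (ℓ ∷_) (ABP.paths (toABP P) f t)) x)
      ≡⟨ ∑-map-concatMap (weight b) _ x ⟩
    ∑ (map (λ (ℓ , t) → pathSum b (map (ℓ ∷_) (ABP.paths (toABP P) f t))) x)
      ≡⟨ cong ∑ (List.map-cong (λ (ℓ , t) → trans (pathSum-cons b ℓ (ABP.paths (toABP P) f t))
                   (cong (⟦ ℓ ⟧ b *_) (pathSum-toABP P b f t (ℕ.≤-trans m≤f (ℕ.m≤n+m f (toℕ t)))))) x) ⟩
    nodeValue b (value P b) x ∎
    where open ≡-Reasoning

  abpEval-toABP : ∀ {n m} (P : Program n m) b → abpEval (toABP P) b ≡ value P b fzero
  abpEval-toABP {m = m} P b = trans (abpEval≡pathSum (toABP P) b) (pathSum-toABP P b (suc m) fzero (ℕ.n≤1+n m))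

  module FromABP {n : ℕ} (g : ABP p n) where
    open ABP g

    Dag : Edge p n (suc v) → Set
    Dag e = toℕ (Edge.from e) < toℕ (Edge.to e)

    from≢ : ∀ {u} e → Dag e → v ≤ toℕ u → Edge.from e ≢ u
    from≢ e dag v≤u refl = ℕ.<-irrefl refl (ℕ.<-≤-trans dag (ℕ.≤-trans (Fin.toℕ≤pred[n] (Edge.to e)) v≤u))

    paths-more-fuel : ∀ f u → v ≤ toℕ u ℕ.+ f → paths f u ≡ paths (suc f) u
    paths-more-fuel zero u v≤u = cong (atSink g u ++_)
      (sym (trans (concatMap-cong-All (All.map (λ {e} dag → no-step e dag) dag)) (concatMap-[] edges)))
      where
      no-step : ∀ e → Dag e → step g 0 u e ≡ []
      no-step e dag with Edge.from e ≟ u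
      ... | yes from≡u = ⊥-elim (from≢ e dag (ℕ.≤-trans v≤u (ℕ.≤-reflexive (ℕ.+-identityʳ _))) from≡u)
      ... | no _ = refl
    paths-more-fuel (suc f) u v≤u+f = cong (atSink g u ++_) (concatMap-cong-All (All.map (λ {e} dag → more-step e dag) dag))
      where
      more-step : ∀ e → Dag e → step g f u e ≡ step g (suc f) u e
      more-step e dag with Edge.from e ≟ u
      ... | yes refl = cong (map (Edge.label e ∷_)) (paths-more-fuel f (Edge.to e)
                         (ℕ.≤-trans v≤u+f (ℕ.≤-trans (ℕ.≤-reflexive (ℕ.+-suc _ f)) (ℕ.+-monoˡ-≤ f dag))))
      ... | no _ = refl

    vertexValue : Vec Bool n → Fin (suc v) → Fin p
    vertexValue b u = pathSum b (paths (suc v) u)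

    edgeTerm : Vec Bool n → Fin (suc v) → Edge p n (suc v) → Fin p
    edgeTerm b u e = if does (Edge.from e ≟ u) then ⟦ Edge.label e ⟧ b * vertexValue b (Edge.to e) else 0#

    vertexValue-step : ∀ b u → vertexValue b u ≡ pathSum b (atSink g u) + ∑ (map (edgeTerm b u) edges)
    vertexValue-step b u = trans (∑-map-++ (weight b) (atSink g u) _)
      (cong (pathSum b (atSink g u) +_) (trans (∑-map-concatMap (weight b) (step g v u) edges) (cong ∑ (List.map-cong each edges))))
      where
      each : ∀ e → pathSum b (step g v u e) ≡ edgeTerm b u e
      each e with Edge.from e ≟ u
      ... | yes _ = trans (pathSum-cons b (Edge.label e) (paths v (Edge.to e)))
                          (cong (λ πs → ⟦ Edge.label e ⟧ b * pathSum b πs) (paths-more-fuel v (Edge.to e) (ℕ.m≤n+m v _)))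
      ... | no _ = refl

    vertexValue-sink : ∀ b → vertexValue b sink ≡ 1#
    vertexValue-sink b = begin
      vertexValue b sink
        ≡⟨ vertexValue-step b sink ⟩
      pathSum b (atSink g sink) + ∑ (map (edgeTerm b sink) edges)
        ≡⟨ cong₂ (λ c s → pathSum b (if c then [] ∷ [] else []) + s) (dec-true (sink ≟ sink) refl)
                 (trans (cong ∑ (List.map-cong-local (All.map (λ {e} dag → none e dag) dag))) (∑-map-0# edges)) ⟩
      (1# + 0#) + 0#
        ≡⟨ trans (R.+-identityʳ _) (R.+-identityʳ 1#) ⟩
      1# ∎
      where
      open ≡-Reasoning
      none : ∀ e → Dag e → edgeTerm b sink e ≡ 0#
      none e dag = cong (λ c → if c then ⟦ Edge.label e ⟧ b * vertexValue b (Edge.to e) else 0#)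
        (dec-false (Edge.from e ≟ sink) (from≢ e dag (ℕ.≤-reflexive (sym (Fin.toℕ-fromℕ v)))))

    ∸-suc : ∀ {k} → k < v → v ∸ k ≡ suc (v ∸ suc k)
    ∸-suc k<v = ℕ.+-∸-assoc 1 k<v

    vertex : ℕ → Fin (suc v)
    vertex k = fromℕ< (s≤s (ℕ.m∸n≤m v k))

    -- `suffix k` below has one node per vertex v ∸ k, …, v: node i is vertex v ∸ k + i. The `mod`
    -- in `local` only makes it total; on the targets that occur it is the identity (toℕ-local).
    local : (k : ℕ) → Fin (suc v) → Fin (suc k)
    local k w = (toℕ w ∸ (v ∸ k)) mod suc k

    toℕ-local : ∀ {k} w → k ≤ v → v ∸ k ≤ toℕ w → toℕ w ≡ v ∸ k ℕ.+ toℕ (local k w)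
    toℕ-local {k} w k≤v v∸k≤w = sym (trans (cong (v ∸ k ℕ.+_) (trans (Fin.toℕ-fromℕ< _) (m<n⇒m%n≡m offset<1+k)))
                                           (ℕ.m+[n∸m]≡n v∸k≤w))
      where
      offset<1+k : toℕ w ∸ (v ∸ k) < suc k
      offset<1+k = s≤s (ℕ.≤-trans (ℕ.∸-monoˡ-≤ (v ∸ k) (Fin.toℕ≤pred[n] w)) (ℕ.≤-reflexive (ℕ.m∸[m∸n]≡n k≤v)))

    outgoing : (k : ℕ) → Node n k
    outgoing k = concatMap (λ e → if does (Edge.from e ≟ vertex (suc k)) then (Edge.label e , local k (Edge.to e)) ∷ [] else []) edges

    suffix : (k : ℕ) → Program n k
    suffix zero = end
    suffix (suc k) = outgoing k ◁ suffix k

    value-suffix : ∀ b k → k ≤ v → ∀ (i : Fin (suc k)) w → toℕ w ≡ v ∸ k ℕ.+ toℕ i →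
                   value (suffix k) b i ≡ vertexValue b w
    value-suffix b zero _ fzero w w≡v+0 = sym (trans (cong (vertexValue b) w≡sink) (vertexValue-sink b))
      where
      w≡sink : w ≡ sink
      w≡sink = Fin.toℕ-injective (trans w≡v+0 (trans (ℕ.+-identityʳ v) (sym (Fin.toℕ-fromℕ v))))
    value-suffix b (suc k) k<v (fsuc i) w w≡ = value-suffix b k (ℕ.<⇒≤ k<v) i w
      (trans w≡ (trans (ℕ.+-suc (v ∸ suc k) (toℕ i)) (cong (ℕ._+ toℕ i) (sym (∸-suc k<v)))))
    value-suffix b (suc k) k<v fzero w w≡
      with Fin.toℕ-injective {i = w} {j = vertex (suc k)} (trans w≡ (trans (ℕ.+-identityʳ _) (sym (Fin.toℕ-fromℕ< _))))
    ... | refl = begin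
      nodeValue b (value (suffix k) b) (outgoing k)
        ≡⟨ ∑-map-concatMap _ _ edges ⟩
      ∑ (map (λ e → nodeValue b (value (suffix k) b)
                      (if does (Edge.from e ≟ w) then (Edge.label e , local k (Edge.to e)) ∷ [] else [])) edges)
        ≡⟨ cong ∑ (List.map-cong-local (All.map (λ {e} dag → each e dag) dag)) ⟩
      ∑ (map (edgeTerm b w) edges)
        ≡⟨ sym (R.+-identityˡ _) ⟩
      0# + ∑ (map (edgeTerm b w) edges)
        ≡⟨ cong (λ c → pathSum b (if c then [] ∷ [] else []) + ∑ (map (edgeTerm b w) edges)) (sym (dec-false (w ≟ sink) w≢sink)) ⟩
      pathSum b (atSink g w) + ∑ (map (edgeTerm b w) edges)
        ≡⟨ sym (vertexValue-step b w) ⟩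
      vertexValue b w ∎
      where
      open ≡-Reasoning
      toℕw≡ : toℕ w ≡ v ∸ suc k
      toℕw≡ = Fin.toℕ-fromℕ< _
      w≢sink : w ≢ sink
      w≢sink w≡sink = ℕ.<-irrefl (trans (sym toℕw≡) (trans (cong toℕ w≡sink) (Fin.toℕ-fromℕ v)))
        (ℕ.∸-monoʳ-< (s≤s z≤n) k<v)
      each : ∀ e → Dag e →
        nodeValue b (value (suffix k) b) (if does (Edge.from e ≟ w) then (Edge.label e , local k (Edge.to e)) ∷ [] else [])
        ≡ edgeTerm b w e
      each e dag with Edge.from e ≟ w
      ... | no _ = refl
      ... | yes refl = trans (R.+-identityʳ _) (cong (⟦ Edge.label e ⟧ b *_)
             (value-suffix b k (ℕ.<⇒≤ k<v) (local k (Edge.to e)) (Edge.to e)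
               (toℕ-local (Edge.to e) (ℕ.<⇒≤ k<v)
                 (ℕ.≤-trans (ℕ.≤-reflexive (∸-suc k<v)) (subst (_< toℕ (Edge.to e)) toℕw≡ dag)))))

    fromABP : Program n v
    fromABP = suffix v

    value-fromABP : ∀ b → value fromABP b fzero ≡ abpEval g b
    value-fromABP b = trans (value-suffix b v ℕ.≤-refl fzero fzero (sym (trans (ℕ.+-identityʳ _) (ℕ.n∸n≡0 v))))
                            (sym (abpEval≡pathSum g b))

  -- `graft X Q w` stacks X on top of Q, with the sink of X replaced by node w of Q.
  redirect : ∀ {m₁ m₂} → Fin (suc m₂) → Fin (suc m₁) → Fin (suc (m₁ ℕ.+ m₂))
  redirect {zero} w _ = w
  redirect {suc m₁} w fzero = fzero
  redirect {suc m₁} w (fsuc i) = fsuc (redirect {m₁} w i)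

  raise : ∀ {m₁ m₂} → Fin (suc m₂) → Fin (suc (m₁ ℕ.+ m₂))
  raise {zero} q = q
  raise {suc m₁} q = fsuc (raise {m₁} q)

  graft : ∀ {n m₁ m₂} → Program n m₁ → Program n m₂ → Fin (suc m₂) → Program n (m₁ ℕ.+ m₂)
  graft end Q w = Q
  graft (x ◁ X) Q w = map (λ (ℓ , t) → ℓ , redirect w t) x ◁ graft X Q w

  value-graft-raise : ∀ {n m₁ m₂} (X : Program n m₁) (Q : Program n m₂) w b q →
                      value (graft X Q w) b (raise {m₁} q) ≡ value Q b q
  value-graft-raise end Q w b q = refl
  value-graft-raise (x ◁ X) Q w b q = value-graft-raise X Q w b q

  value-graft-redirect : ∀ {n m₁ m₂} (X : Program n m₁) (Q : Program n m₂) w b r →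
                         value (graft X Q w) b (redirect w r) ≡ value X b r * value Q b w
  value-graft-redirect end Q w b fzero = sym (R.*-identityˡ _)
  value-graft-redirect (x ◁ X) Q w b (fsuc r) = value-graft-redirect X Q w b r
  value-graft-redirect (x ◁ X) Q w b fzero = begin
    ∑ (map (λ (ℓ , t) → ⟦ ℓ ⟧ b * value (graft X Q w) b t) (map (λ (ℓ , t) → ℓ , redirect w t) x))
      ≡⟨ cong ∑ (sym (List.map-∘ x)) ⟩
    ∑ (map (λ (ℓ , t) → ⟦ ℓ ⟧ b * value (graft X Q w) b (redirect w t)) x)
      ≡⟨ cong ∑ (List.map-cong (λ (ℓ , t) →
           trans (cong (⟦ ℓ ⟧ b *_) (value-graft-redirect X Q w b t)) (sym (R.*-assoc _ _ _))) x) ⟩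
    ∑ (map (λ (ℓ , t) → ⟦ ℓ ⟧ b * value X b t * value Q b w) x)
      ≡⟨ sym (*-distribʳ-∑-map (value Q b w) (λ (ℓ , t) → ⟦ ℓ ⟧ b * value X b t) x) ⟩
    nodeValue b (value X b) x * value Q b w ∎
    where open ≡-Reasoning

  ⟦cst⟧ : ∀ {n} (c : Fin p) b → ⟦ cst {n = n} c ⟧ b ≡ c
  ⟦cst⟧ c b = mod-toℕ c

  SomeProgram : ℕ → Set
  SomeProgram n = Σ ℕ (Program n)

  out : ∀ {n} → SomeProgram n → Vec Bool n → Fin p
  out (_ , P) b = value P b fzero

  linearRoot : ∀ {n m₁ m₂} → Fin p → Program n m₁ → Fin (suc m₂) → Fin p → Program n m₂ → Program n (suc (m₁ ℕ.+ m₂))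
  linearRoot {m₁ = m₁} c X w d Q = ((cst c , redirect {m₁} w fzero) ∷ (cst d , raise {m₁} fzero) ∷ []) ◁ graft X Q w

  value-linearRoot : ∀ {n m₁ m₂} c (X : Program n m₁) w d (Q : Program n m₂) b →
    value (linearRoot c X w d Q) b fzero ≡ c * (value X b fzero * value Q b w) + d * value Q b fzero
  value-linearRoot {m₁ = m₁} c X w d Q b = begin
    ⟦ cst c ⟧ b * value (graft X Q w) b (redirect w fzero) + (⟦ cst d ⟧ b * value (graft X Q w) b (raise {m₁} fzero) + 0#)
      ≡⟨ cong₂ (λ u v → u + v) (cong₂ _*_ (⟦cst⟧ c b) (value-graft-redirect X Q w b fzero))
                               (trans (R.+-identityʳ _) (cong₂ _*_ (⟦cst⟧ d b) (value-graft-raise X Q w b fzero))) ⟩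
    c * (value X b fzero * value Q b w) + d * value Q b fzero ∎
    where open ≡-Reasoning

  infixl 6 _⊕_
  _⊕_ : ∀ {n} → SomeProgram n → SomeProgram n → SomeProgram n
  (m₁ , X) ⊕ (m₂ , Q) = suc (m₁ ℕ.+ m₂) , linearRoot 1# X (fromℕ m₂) 1# Q

  out-⊕ : ∀ {n} (X Q : SomeProgram n) b → out (X ⊕ Q) b ≡ out X b + out Q b
  out-⊕ (m₁ , X) (m₂ , Q) b = trans (value-linearRoot 1# X (fromℕ m₂) 1# Q b)
    (trans (cong (λ q → 1# * (value X b fzero * q) + 1# * value Q b fzero) (value-sink Q b))
           (solve 2 (λ x q → con ℤ.1ℤ :* (x :* con ℤ.1ℤ) :+ con ℤ.1ℤ :* q := x :+ q) refl (value X b fzero) (value Q b fzero)))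

  mulSub : ∀ {n} → SomeProgram n → Fin p → SomeProgram n → SomeProgram n
  mulSub (m₁ , X) s (m₂ , Q) = suc (m₁ ℕ.+ m₂) , linearRoot 1# X fzero (- s) Q

  out-mulSub : ∀ {n} (X : SomeProgram n) s Q b → out (mulSub X s Q) b ≡ out Q b * (out X b - s)
  out-mulSub (m₁ , X) s (m₂ , Q) b = trans (value-linearRoot 1# X fzero (- s) Q b)
    (solve 3 (λ x q s → con ℤ.1ℤ :* (x :* q) :+ :- s :* q := q :* (x :- s)) refl (value X b fzero) (value Q b fzero) s)

  ∏-sub : ∀ {n} → List (SomeProgram n × Fin p) → SomeProgram n
  ∏-sub [] = 0 , end
  ∏-sub ((X , s) ∷ fs) = mulSub X s (∏-sub fs)

  out-∏-sub : ∀ {n} (fs : List (SomeProgram n × Fin p)) b → out (∏-sub fs) b ≡ ∏ (map (λ (X , s) → out X b - s) fs)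
  out-∏-sub [] b = refl
  out-∏-sub ((X , s) ∷ fs) b = trans (out-mulSub X s (∏-sub fs) b)
    (trans (R.*-comm _ _) (cong ((out X b - s) *_) (out-∏-sub fs b)))

  ∑ᵖ : ∀ {n} k → (Fin k → SomeProgram n) → SomeProgram n
  ∑ᵖ zero _ = 1 , [] ◁ end
  ∑ᵖ (suc k) P = P fzero ⊕ ∑ᵖ k (P ∘ fsuc)

  out-∑ᵖ : ∀ {n} k (P : Fin k → SomeProgram n) b → out (∑ᵖ k P) b ≡ ∑[ i < k ] out (P i) b
  out-∑ᵖ zero P b = refl
  out-∑ᵖ (suc k) P b = trans (out-⊕ (P fzero) (∑ᵖ k (P ∘ fsuc)) b) (cong (out (P fzero) b +_) (out-∑ᵖ k (P ∘ fsuc) b))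

-- Circuits over 𝔸 and linear programs

module CircuitEvaluation (A : FiniteAlgebra) where
  open FiniteAlgebra A

  gateValue : ∀ {n j} → Circuit A n j → (Fin n → Fin size) → Fin j → Fin size
  gateValue C x k = lookup (evalCircuit A C x) k

  private
    lookup-∷ʳ-inject₁ : ∀ {X : Set} {j} (xs : Vec X j) y k → lookup (xs ∷ʳ y) (inject₁ k) ≡ lookup xs k
    lookup-∷ʳ-inject₁ (x ∷ xs) y fzero = refl
    lookup-∷ʳ-inject₁ (x ∷ xs) y (fsuc k) = lookup-∷ʳ-inject₁ xs y k

    lookup-∷ʳ-last : ∀ {X : Set} {j} (xs : Vec X j) y → lookup (xs ∷ʳ y) (fromℕ j) ≡ y
    lookup-∷ʳ-last [] y = refl
    lookup-∷ʳ-last (x ∷ xs) y = lookup-∷ʳ-last xs y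

  gateValue-inject₁ : ∀ {n j} (C : Circuit A n j) g x k → gateValue (C ▷ g) x (inject₁ k) ≡ gateValue C x k
  gateValue-inject₁ C g x k = lookup-∷ʳ-inject₁ (evalCircuit A C x) _ k

  gateValue-last : ∀ {n j} (C : Circuit A n j) g x → gateValue (C ▷ g) x (fromℕ j) ≡ evalGate A g x (evalCircuit A C x)
  gateValue-last C g x = lookup-∷ʳ-last (evalCircuit A C x) _

  output≡gateValue : ∀ {n s} (C : Circuit A n (suc s)) x → output A C x ≡ gateValue C x (fromℕ s)
  output≡gateValue (C ▷ g) x = trans (Vec.last-∷ʳ _ (evalCircuit A C x)) (sym (gateValue-last C g x))

module AffineForms (p : ℕ) .{{_ : NonZero p}} where
  open IntegersModulo p
  open PairAlgebra p
  open LinearPrograms p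
  private module R = CommutativeRing ℤₚ

  Affine : ℕ → Set
  Affine n = Fin p × (Fin n → Fin p)

  bit : ∀ {n} → Vec Bool n → Fin n → Fin p
  bit b i = ⟦ var i ⟧ b

  ⟦_⟧ᵃ : ∀ {n} → Affine n → Vec Bool n → Fin p
  ⟦_⟧ᵃ {n} (c , r) b = c + ∑[ i < n ] (r i * bit b i)

  ∑-mal : ∀ {k} (f g h : Fin k → Fin p) →
    ∑[ i < k ] mal (f i) (g i) (h i) ≡ mal (∑[ i < k ] f i) (∑[ i < k ] g i) (∑[ i < k ] h i)
  ∑-mal {zero} f g h = sym mal-0#
  ∑-mal {suc k} f g h = trans (cong (mal (f fzero) (g fzero) (h fzero) +_) (∑-mal (f ∘ fsuc) (g ∘ fsuc) (h ∘ fsuc)))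
                              (mal-+ _ _ _ _ _ _)

  affine-mal : ∀ {n} → Affine n → Affine n → Affine n → Affine n
  affine-mal (c₀ , r₀) (c₁ , r₁) (c₂ , r₂) = mal c₀ c₁ c₂ , λ i → mal (r₀ i) (r₁ i) (r₂ i)

  ⟦affine-mal⟧ : ∀ {n} (a₀ a₁ a₂ : Affine n) b →
                 ⟦ affine-mal a₀ a₁ a₂ ⟧ᵃ b ≡ mal (⟦ a₀ ⟧ᵃ b) (⟦ a₁ ⟧ᵃ b) (⟦ a₂ ⟧ᵃ b)
  ⟦affine-mal⟧ {n} (c₀ , r₀) (c₁ , r₁) (c₂ , r₂) b = begin
    mal c₀ c₁ c₂ + ∑[ i < n ] (mal (r₀ i) (r₁ i) (r₂ i) * bit b i)
      ≡⟨ cong (mal c₀ c₁ c₂ +_) (trans (sum-cong-≗ (λ i → mal-*ʳ (r₀ i) (r₁ i) (r₂ i) (bit b i)))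
                                       (∑-mal (λ i → r₀ i * bit b i) (λ i → r₁ i * bit b i) (λ i → r₂ i * bit b i))) ⟩
    mal c₀ c₁ c₂ + mal (∑[ i < n ] (r₀ i * bit b i)) (∑[ i < n ] (r₁ i * bit b i)) (∑[ i < n ] (r₂ i * bit b i))
      ≡⟨ mal-+ _ _ _ _ _ _ ⟩
    mal (⟦ c₀ , r₀ ⟧ᵃ b) (⟦ c₁ , r₁ ⟧ᵃ b) (⟦ c₂ , r₂ ⟧ᵃ b) ∎
    where open ≡-Reasoning

  affine-const : ∀ {n} → Fin p → Affine n
  affine-const c = c , λ _ → 0#

  ⟦affine-const⟧ : ∀ {n} c (b : Vec Bool n) → ⟦ affine-const c ⟧ᵃ b ≡ c
  ⟦affine-const⟧ {n} c b = trans (cong (c +_) (trans (sum-cong-≗ (λ i → R.zeroˡ (bit b i))) (sum-replicate-zero n))) (R.+-identityʳ c)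

  affine-input : ∀ {n} → Fin n → Fin p → Fin p → Affine n
  affine-input i u₀ u₁ = u₀ , λ j → if does (j ≟ i) then u₁ - u₀ else 0#

  ⟦affine-input⟧ : ∀ {n} i u₀ u₁ (b : Vec Bool n) → ⟦ affine-input i u₀ u₁ ⟧ᵃ b ≡ (if lookup b i then u₁ else u₀)
  ⟦affine-input⟧ {n} i u₀ u₁ b = trans (cong (u₀ +_) (trans (∑-single _ i off-i) at-i)) (by-bit (lookup b i))
    where
    off-i : ∀ j → j ≢ i → (if does (j ≟ i) then u₁ - u₀ else 0#) * bit b j ≡ 0#
    off-i j j≢i = trans (cong (λ c → (if c then u₁ - u₀ else 0#) * bit b j) (dec-false (j ≟ i) j≢i)) (R.zeroˡ _)
    at-i : (if does (i ≟ i) then u₁ - u₀ else 0#) * bit b i ≡ (u₁ - u₀) * bit b i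
    at-i = cong (λ c → (if c then u₁ - u₀ else 0#) * bit b i) (dec-true (i ≟ i) refl)
    by-bit : ∀ c → u₀ + (u₁ - u₀) * ((if c then 1 else 0) mod p) ≡ (if c then u₁ else u₀)
    by-bit true = solve 2 (λ u₀ u₁ → u₀ :+ (u₁ :- u₀) :* con ℤ.1ℤ := u₁) refl u₀ u₁
    by-bit false = solve 2 (λ u₀ u₁ → u₀ :+ (u₁ :- u₀) :* con ℤ.0ℤ := u₀) refl u₀ u₁

  -- The coefficient r i of x_i is encoded as r i copies of the term (var i , t).
  affineTerms : ∀ {n m} → Affine n → Fin (suc m) → Node n m
  affineTerms {n} (c , r) t = (cst c , t) ∷ concat (map (λ i → replicate (toℕ (r i)) (var i , t)) (allFin n))

  nodeValue-affineTerms : ∀ {n m} (a : Affine n) t b (V : Fin (suc m) → Fin p) →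
    nodeValue b V (affineTerms a t) ≡ ⟦ a ⟧ᵃ b * V t
  nodeValue-affineTerms {n} (c , r) t b V = begin
    ⟦ cst c ⟧ b * V t + ∑ (map term (concat (map (λ i → replicate (toℕ (r i)) (var i , t)) (allFin n))))
      ≡⟨ cong₂ _+_ (cong (_* V t) (⟦cst⟧ c b)) (∑-map-concatMap term _ (allFin n)) ⟩
    c * V t + ∑ (map (λ i → ∑ (map term (replicate (toℕ (r i)) (var i , t)))) (allFin n))
      ≡⟨ cong (c * V t +_) (cong ∑ (List.map-cong (λ i → trans (∑-map-replicate term (toℕ (r i)) (var i , t))
                                                          (trans (cong (_* _) (mod-toℕ (r i))) (sym (R.*-assoc _ _ _)))) (allFin n))) ⟩
    c * V t + ∑ (map (λ i → r i * bit b i * V t) (allFin n))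
      ≡⟨ cong (c * V t +_) (trans (∑-allFin (λ i → r i * bit b i * V t)) (sym (*-distribʳ-sum (V t) (λ i → r i * bit b i)))) ⟩
    c * V t + ∑[ i < n ] (r i * bit b i) * V t
      ≡⟨ sym (R.distribʳ (V t) c _) ⟩
    ⟦ c , r ⟧ᵃ b * V t ∎
    where
    open ≡-Reasoning
    term : Label p n × Fin (suc _) → Fin p
    term (ℓ , u) = ⟦ ℓ ⟧ b * V u

module CircuitToProgram (p : ℕ) .{{_ : NonZero p}} {n : ℕ} (ι : Bool → Fin (p ℕ.* p)) where
  open IntegersModulo p
  open PairAlgebra p
  open LinearPrograms p
  open AffineForms p
  open CircuitEvaluation 𝔸
  private module R = CommutativeRing ℤₚ

  inputs : Vec Bool n → Fin n → E
  inputs b i = ι (lookup b i)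

  by-input : ∀ (π : E → Fin p) c → π (ι c) ≡ (if c then π (ι true) else π (ι false))
  by-input π true = refl
  by-input π false = refl

  zGateForm : ∀ {j} → (Fin j → Affine n) → Gate 𝔸 n j → Affine n
  zGateForm zs (input i) = affine-input i (π₂ (ι false)) (π₂ (ι true))
  zGateForm zs (const a) = affine-const (π₂ a)
  zGateForm zs (gate 0F args) = affine-mal (zs (args 0F)) (zs (args 1F)) (zs (args 2F))
  zGateForm zs (gate 1F args) = affine-const 0#

  zForm : ∀ {j} → Circuit 𝔸 n j → Fin j → Affine n
  zForm (C ▷ g) k with view k
  ... | ‵fromℕ = zGateForm (zForm C) g
  ... | ‵inject₁ k′ = zForm C k′

  π₂-gate : ∀ {j} (C : Circuit 𝔸 n j) b → (∀ k → π₂ (gateValue C (inputs b) k) ≡ ⟦ zForm C k ⟧ᵃ b) →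
    ∀ g → π₂ (evalGate 𝔸 g (inputs b) (evalCircuit 𝔸 C (inputs b))) ≡ ⟦ zGateForm (zForm C) g ⟧ᵃ b
  π₂-gate C b IH (input i) = trans (by-input π₂ (lookup b i)) (sym (⟦affine-input⟧ i _ _ b))
  π₂-gate C b IH (const a) = sym (⟦affine-const⟧ (π₂ a) b)
  π₂-gate C b IH (gate 0F args) =
    trans (π₂-d _ _ _) (trans (cong₃ mal (IH (args 0F)) (IH (args 1F)) (IH (args 2F))) (sym (⟦affine-mal⟧ _ _ _ b)))
  π₂-gate C b IH (gate 1F args) = trans (π₂-f _ _ _) (sym (⟦affine-const⟧ 0# b))

  π₂-gateValue : ∀ {j} (C : Circuit 𝔸 n j) b k → π₂ (gateValue C (inputs b) k) ≡ ⟦ zForm C k ⟧ᵃ b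
  π₂-gateValue (C ▷ g) b k with view k
  ... | ‵fromℕ = trans (cong π₂ (gateValue-last C g _)) (π₂-gate C b (π₂-gateValue C b) g)
  ... | ‵inject₁ k′ = trans (cong π₂ (gateValue-inject₁ C g _ k′)) (π₂-gateValue C b k′)

  -- Gates are numbered from the inputs up, program nodes from the root down; gate k is node pos k.
  pos : ∀ {j} → Fin j → Fin (suc j)
  pos k = inject₁ (opposite k)

  pos-inject₁ : ∀ {j} (k : Fin j) → pos {suc j} (inject₁ k) ≡ fsuc (pos k)
  pos-inject₁ {j} k = Fin.toℕ-injective (begin
    toℕ (inject₁ (opposite (inject₁ k)))  ≡⟨ Fin.toℕ-inject₁ _ ⟩
    toℕ (opposite (inject₁ k))            ≡⟨ Fin.opposite-prop (inject₁ k) ⟩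
    j ∸ toℕ (inject₁ k)                   ≡⟨ cong (j ∸_) (Fin.toℕ-inject₁ k) ⟩
    j ∸ toℕ k                             ≡⟨ ℕ.+-∸-assoc 1 (Fin.toℕ<n k) ⟩
    suc (j ∸ suc (toℕ k))                 ≡⟨ cong suc (sym (trans (Fin.toℕ-inject₁ _) (Fin.opposite-prop k))) ⟩
    toℕ (fsuc (inject₁ (opposite k)))     ∎)
    where open ≡-Reasoning

  pos-last : ∀ j → pos {suc j} (fromℕ j) ≡ fzero
  pos-last j = Fin.toℕ-injective (trans (Fin.toℕ-inject₁ _)
    (trans (Fin.opposite-prop (fromℕ j)) (trans (cong (j ∸_) (Fin.toℕ-fromℕ j)) (ℕ.n∸n≡0 j))))

  aNode : ∀ {j} → (Fin j → Affine n) → Gate 𝔸 n j → Node n j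
  aNode zs (input i) = affineTerms (affine-input i (π₁ (ι false)) (π₁ (ι true))) (fromℕ _)
  aNode zs (const a) = (cst (π₁ a) , fromℕ _) ∷ []
  aNode zs (gate 0F args) = (cst 1# , pos (args 0F)) ∷ (cst (- 1#) , pos (args 1F)) ∷ (cst 1# , pos (args 2F)) ∷ []
  aNode zs (gate 1F args) = (cst 1# , pos (args 0F)) ∷ affineTerms (zs (args 2F)) (pos (args 1F))

  aProgram : ∀ {j} → Circuit 𝔸 n j → Program n j
  aProgram [] = end
  aProgram (C ▷ g) = aNode (zForm C) g ◁ aProgram C

  π₁-gate : ∀ {j} (C : Circuit 𝔸 n j) b → (∀ k → value (aProgram C) b (pos k) ≡ π₁ (gateValue C (inputs b) k)) →
    ∀ g → nodeValue b (value (aProgram C) b) (aNode (zForm C) g) ≡ π₁ (evalGate 𝔸 g (inputs b) (evalCircuit 𝔸 C (inputs b)))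
  π₁-gate {j} C b IH (input i) = begin
    nodeValue b V (affineTerms (affine-input i (π₁ (ι false)) (π₁ (ι true))) (fromℕ j))
      ≡⟨ nodeValue-affineTerms _ (fromℕ j) b V ⟩
    ⟦ affine-input i (π₁ (ι false)) (π₁ (ι true)) ⟧ᵃ b * V (fromℕ j)
      ≡⟨ cong₂ _*_ (⟦affine-input⟧ i _ _ b) (value-sink (aProgram C) b) ⟩
    (if lookup b i then π₁ (ι true) else π₁ (ι false)) * 1#
      ≡⟨ trans (R.*-identityʳ _) (sym (by-input π₁ (lookup b i))) ⟩
    π₁ (ι (lookup b i)) ∎
    where
    open ≡-Reasoning
    V = value (aProgram C) b
  π₁-gate {j} C b IH (const a) =
    trans (cong₂ (λ c v → c * v + 0#) (⟦cst⟧ (π₁ a) b) (value-sink (aProgram C) b))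
          (trans (R.+-identityʳ _) (R.*-identityʳ (π₁ a)))
  π₁-gate C b IH (gate 0F args) = begin
    ⟦ cst 1# ⟧ b * V (pos a₀) + (⟦ cst (- 1#) ⟧ b * V (pos a₁) + (⟦ cst 1# ⟧ b * V (pos a₂) + 0#))
      ≡⟨ cong₃ (λ u v w → u + (v + (w + 0#))) (cong₂ _*_ (⟦cst⟧ 1# b) (IH a₀))
                (cong₂ _*_ (⟦cst⟧ (- 1#) b) (IH a₁)) (cong₂ _*_ (⟦cst⟧ 1# b) (IH a₂)) ⟩
    1# * π₁ x₀ + (- 1# * π₁ x₁ + (1# * π₁ x₂ + 0#))
      ≡⟨ solve 3 (λ u v w → con ℤ.1ℤ :* u :+ (:- con ℤ.1ℤ :* v :+ (con ℤ.1ℤ :* w :+ con ℤ.0ℤ)) := u :- v :+ w) refl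
               (π₁ x₀) (π₁ x₁) (π₁ x₂) ⟩
    mal (π₁ x₀) (π₁ x₁) (π₁ x₂)
      ≡⟨ sym (π₁-d x₀ x₁ x₂) ⟩
    π₁ (d x₀ x₁ x₂) ∎
    where
    open ≡-Reasoning
    V = value (aProgram C) b
    a₀ = args 0F
    a₁ = args 1F
    a₂ = args 2F
    x₀ = gateValue C (inputs b) a₀
    x₁ = gateValue C (inputs b) a₁
    x₂ = gateValue C (inputs b) a₂
  π₁-gate C b IH (gate 1F args) = begin
    ⟦ cst 1# ⟧ b * V (pos (args 0F)) + nodeValue b V (affineTerms (zForm C (args 2F)) (pos (args 1F)))
      ≡⟨ cong₂ _+_ (cong₂ _*_ (⟦cst⟧ 1# b) (IH (args 0F))) (nodeValue-affineTerms _ (pos (args 1F)) b V) ⟩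
    1# * π₁ x₀ + ⟦ zForm C (args 2F) ⟧ᵃ b * V (pos (args 1F))
      ≡⟨ cong₃ (λ u z v → u + z * v) (R.*-identityˡ (π₁ x₀)) (sym (π₂-gateValue C b (args 2F))) (IH (args 1F)) ⟩
    π₁ x₀ + π₂ x₂ * π₁ x₁
      ≡⟨ cong (π₁ x₀ +_) (R.*-comm (π₂ x₂) (π₁ x₁)) ⟩
    π₁ x₀ + π₁ x₁ * π₂ x₂
      ≡⟨ sym (π₁-f x₀ x₁ x₂) ⟩
    π₁ (f x₀ x₁ x₂) ∎
    where
    open ≡-Reasoning
    V = value (aProgram C) b
    x₀ = gateValue C (inputs b) (args 0F)
    x₁ = gateValue C (inputs b) (args 1F)
    x₂ = gateValue C (inputs b) (args 2F)

  value-aProgram : ∀ {j} (C : Circuit 𝔸 n j) b k → value (aProgram C) b (pos k) ≡ π₁ (gateValue C (inputs b) k)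
  value-aProgram (C ▷ g) b k with view k
  ... | ‵fromℕ = trans (cong (value (aProgram (C ▷ g)) b) (pos-last _))
                   (trans (π₁-gate C b (value-aProgram C b) g) (sym (cong π₁ (gateValue-last C g _))))
  ... | ‵inject₁ k′ = trans (cong (value (aProgram (C ▷ g)) b) (pos-inject₁ k′))
                        (trans (value-aProgram C b k′) (sym (cong π₁ (gateValue-inject₁ C g _ k′))))

  π₁-output : ∀ {s} (C : Circuit 𝔸 n (suc s)) b → value (aProgram C) b fzero ≡ π₁ (output 𝔸 C (inputs b))
  π₁-output {s} C b = trans (cong (value (aProgram C) b) (sym (pos-last s)))
    (trans (value-aProgram C b (fromℕ s)) (cong π₁ (sym (output≡gateValue C (inputs b)))))

  π₂-output : ∀ {s} (C : Circuit 𝔸 n (suc s)) b → ⟦ zForm C (fromℕ s) ⟧ᵃ b ≡ π₂ (output 𝔸 C (inputs b))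
  π₂-output {s} C b = trans (sym (π₂-gateValue C b (fromℕ s))) (cong π₂ (sym (output≡gateValue C (inputs b))))

module ProgramToCircuit (p : ℕ) .{{_ : NonZero p}} where
  open IntegersModulo p
  open PairAlgebra p
  open LinearPrograms p
  open CircuitEvaluation 𝔸
  private module R = CommutativeRing ℤₚ

  ι₀ : Bool → E
  ι₀ c = ⟨ 0# , (if c then 1# else 0#) ⟩

  module _ {n : ℕ} where

    inputs₀ : Vec Bool n → Fin n → E
    inputs₀ b i = ι₀ (lookup b i)

    labelGate : ∀ {j} → Label p n → Gate 𝔸 n j
    labelGate (var i) = input i
    labelGate (cst c) = const ⟨ 0# , c ⟩

    π₂-labelGate : ∀ {j} (ℓ : Label p n) b (v : Vec E j) → π₂ (evalGate 𝔸 (labelGate ℓ) (inputs₀ b) v) ≡ ⟦ ℓ ⟧ b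
    π₂-labelGate (var i) b v with lookup b i
    ... | true = π₂-⟨⟩ 0# 1#
    ... | false = π₂-⟨⟩ 0# 0#
    π₂-labelGate (cst c) b v = trans (π₂-⟨⟩ 0# c) (sym (mod-toℕ c))

    -- f(acc, v, ℓ) has first coordinate π₁ acc + π₁ v · π₂ ℓ, and a label gate puts ⟦ ℓ ⟧ into the
    -- second coordinate: `accumulate` adds one term of a node with two gates.
    fmaGate : ∀ {j} → Fin j → Fin j → Fin j → Gate 𝔸 n j
    fmaGate acc v ℓ = gate 1F λ { 0F → acc ; 1F → v ; 2F → ℓ }

    termGates : ∀ {m} → Node n m → ℕ → ℕ
    termGates [] k = k
    termGates (_ ∷ ts) k = termGates ts (suc (suc k))

    liftPast : ∀ {m} (ts : Node n m) {k} → Fin (suc k) → Fin (suc (termGates ts k))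
    liftPast [] i = i
    liftPast (_ ∷ ts) i = liftPast ts (inject₁ (inject₁ i))

    accumulate : ∀ {m k} (ts : Node n m) → Circuit 𝔸 n (suc k) → (Fin (suc m) → Fin (suc k)) → Circuit 𝔸 n (suc (termGates ts k))
    accumulate [] D loc = D
    accumulate {k = k} ((ℓ , t) ∷ ts) D loc =
      accumulate ts ((D ▷ labelGate ℓ) ▷ fmaGate (inject₁ (fromℕ k)) (inject₁ (loc t)) (fromℕ (suc k)))
                    (inject₁ ∘ inject₁ ∘ loc)

    gateCount : ∀ {m} → Program n m → ℕ
    gateCount end = 0
    gateCount (x ◁ P) = termGates x (suc (gateCount P))

    compile : ∀ {m} (P : Program n m) → Circuit 𝔸 n (suc (gateCount P))
    location : ∀ {m} (P : Program n m) → Fin (suc m) → Fin (suc (gateCount P))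
    compile end = [] ▷ const ⟨ 1# , 0# ⟩
    compile (x ◁ P) = accumulate x (compile P ▷ const ⟨ 0# , 0# ⟩) (inject₁ ∘ location P)
    location end _ = fzero
    location (x ◁ P) fzero = fromℕ (gateCount (x ◁ P))
    location (x ◁ P) (fsuc u) = liftPast x (inject₁ (location P u))

    gateValue-liftPast : ∀ {m k} (ts : Node n m) (D : Circuit 𝔸 n (suc k)) loc x i →
      gateValue (accumulate ts D loc) x (liftPast ts i) ≡ gateValue D x i
    gateValue-liftPast [] D loc x i = refl
    gateValue-liftPast ((ℓ , t) ∷ ts) D loc x i = trans (gateValue-liftPast ts _ _ x (inject₁ (inject₁ i)))
      (trans (gateValue-inject₁ (D ▷ labelGate ℓ) (fmaGate (inject₁ (fromℕ _)) (inject₁ (loc t)) (fromℕ _)) x (inject₁ i))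
             (gateValue-inject₁ D (labelGate ℓ) x i))

    π₁-accumulate : ∀ {m k} (ts : Node n m) (D : Circuit 𝔸 n (suc k)) loc b (V : Fin (suc m) → Fin p) →
      (∀ u → π₁ (gateValue D (inputs₀ b) (loc u)) ≡ V u) →
      π₁ (gateValue (accumulate ts D loc) (inputs₀ b) (fromℕ (termGates ts k)))
        ≡ π₁ (gateValue D (inputs₀ b) (fromℕ k)) + nodeValue b V ts
    π₁-accumulate [] D loc b V locV = sym (R.+-identityʳ _)
    π₁-accumulate {k = k} ((ℓ , t) ∷ ts) D loc b V locV = begin
      π₁ (gateValue (accumulate ts D₂ loc₂) x (fromℕ (termGates ts (suc (suc k)))))
        ≡⟨ π₁-accumulate ts D₂ loc₂ b V locV₂ ⟩
      π₁ (gateValue D₂ x (fromℕ (suc (suc k)))) + nodeValue b V ts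
        ≡⟨ cong (λ z → π₁ z + nodeValue b V ts) (gateValue-last D₁ fma x) ⟩
      π₁ (f (old (fromℕ k)) (old (loc t)) (gateValue D₁ x (fromℕ (suc k)))) + nodeValue b V ts
        ≡⟨ cong (_+ nodeValue b V ts) (π₁-f _ _ _) ⟩
      π₁ (old (fromℕ k)) + π₁ (old (loc t)) * π₂ (gateValue D₁ x (fromℕ (suc k))) + nodeValue b V ts
        ≡⟨ cong₃ (λ a v l → a + v * l + nodeValue b V ts) (cong π₁ (gateValue-inject₁ D (labelGate ℓ) x (fromℕ k)))
             (trans (cong π₁ (gateValue-inject₁ D (labelGate ℓ) x (loc t))) (locV t))
             (trans (cong π₂ (gateValue-last D (labelGate ℓ) x)) (π₂-labelGate ℓ b (evalCircuit 𝔸 D x))) ⟩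
      π₁ (gateValue D x (fromℕ k)) + V t * ⟦ ℓ ⟧ b + nodeValue b V ts
        ≡⟨ solve 4 (λ a v l r → a :+ v :* l :+ r := a :+ (l :* v :+ r)) refl _ (V t) (⟦ ℓ ⟧ b) (nodeValue b V ts) ⟩
      π₁ (gateValue D x (fromℕ k)) + (⟦ ℓ ⟧ b * V t + nodeValue b V ts) ∎
      where
      open ≡-Reasoning
      x = inputs₀ b
      D₁ = D ▷ labelGate ℓ
      fma = fmaGate (inject₁ (fromℕ k)) (inject₁ (loc t)) (fromℕ (suc k))
      D₂ = D₁ ▷ fma
      loc₂ = inject₁ ∘ inject₁ ∘ loc
      old : Fin (suc k) → E
      old i = gateValue D₁ x (inject₁ i)
      locV₂ : ∀ u → π₁ (gateValue D₂ x (loc₂ u)) ≡ V u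
      locV₂ u = trans (cong π₁ (trans (gateValue-inject₁ D₁ fma x _) (gateValue-inject₁ D (labelGate ℓ) x (loc u)))) (locV u)

    π₁-compile : ∀ {m} (P : Program n m) b u → π₁ (gateValue (compile P) (inputs₀ b) (location P u)) ≡ value P b u
    π₁-compile end b u = π₁-⟨⟩ 1# 0#
    π₁-compile (x ◁ P) b (fsuc u) = trans
      (cong π₁ (trans (gateValue-liftPast x _ _ (inputs₀ b) _)
                      (gateValue-inject₁ (compile P) (const ⟨ 0# , 0# ⟩) (inputs₀ b) (location P u))))
      (π₁-compile P b u)
    π₁-compile (x ◁ P) b fzero = begin
      π₁ (gateValue (compile (x ◁ P)) (inputs₀ b) (fromℕ (gateCount (x ◁ P))))
        ≡⟨ π₁-accumulate x D (inject₁ ∘ location P) b (value P b) locV ⟩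
      π₁ (gateValue D (inputs₀ b) (fromℕ (suc (gateCount P)))) + nodeValue b (value P b) x
        ≡⟨ cong (λ z → π₁ z + nodeValue b (value P b) x) (gateValue-last (compile P) (const ⟨ 0# , 0# ⟩) (inputs₀ b)) ⟩
      π₁ ⟨ 0# , 0# ⟩ + nodeValue b (value P b) x
        ≡⟨ trans (cong (_+ nodeValue b (value P b) x) (π₁-⟨⟩ 0# 0#)) (R.+-identityˡ _) ⟩
      nodeValue b (value P b) x ∎
      where
      open ≡-Reasoning
      D = compile P ▷ const ⟨ 0# , 0# ⟩
      locV : ∀ u → π₁ (gateValue D (inputs₀ b) (inject₁ (location P u))) ≡ value P b u
      locV u = trans (cong π₁ (gateValue-inject₁ (compile P) (const ⟨ 0# , 0# ⟩) (inputs₀ b) (location P u))) (π₁-compile P b u)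

    π₁-output-compile : ∀ {m} (P : Program n m) b → π₁ (output 𝔸 (compile P) (inputs₀ b)) ≡ value P b fzero
    π₁-output-compile end b = trans (cong π₁ (output≡gateValue (compile end) (inputs₀ b))) (π₁-compile end b fzero)
    π₁-output-compile (x ◁ P) b = trans (cong π₁ (output≡gateValue (compile (x ◁ P)) (inputs₀ b))) (π₁-compile (x ◁ P) b fzero)

-- Size bounds

-- Bounds by c · (n + 1) ^ c compose, also at n = 0; bounded⇒poly and poly⇒bounded translate from
-- and to the c · n ^ c + c of the definitions.
module PolynomialBounds where
  open import Data.Nat using (_+_; _*_; _^_)
  open import Data.Nat.Properties

  PolyBounded : (ℕ → ℕ) → Set
  PolyBounded f = Σ ℕ λ c → ∀ n → f n ≤ c * suc n ^ c

  poly-≤ : ∀ {f g : ℕ → ℕ} → (∀ n → f n ≤ g n) → PolyBounded g → PolyBounded f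
  poly-≤ f≤g (c , g≤) = c , λ n → ≤-trans (f≤g n) (g≤ n)

  poly-const : ∀ k → PolyBounded (λ _ → k)
  poly-const k = k , λ n → ≤-trans (≤-reflexive (sym (*-identityʳ k))) (*-monoʳ-≤ k (m^n>0 (suc n) k))

  poly-id : PolyBounded (λ n → n)
  poly-id = 1 , λ n → ≤-trans (n≤1+n n) (≤-reflexive (sym (trans (*-identityˡ _) (*-identityʳ (suc n)))))

  poly-+ : ∀ {f g} → PolyBounded f → PolyBounded g → PolyBounded (λ n → f n + g n)
  poly-+ (c , f≤) (d , g≤) = c + d , λ n → begin
    _                                       ≤⟨ +-mono-≤ (f≤ n) (g≤ n) ⟩
    c * suc n ^ c + d * suc n ^ d           ≤⟨ +-mono-≤ (*-monoʳ-≤ c (^-monoʳ-≤ (suc n) (m≤m+n c d)))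
                                                         (*-monoʳ-≤ d (^-monoʳ-≤ (suc n) (m≤n+m d c))) ⟩
    c * suc n ^ (c + d) + d * suc n ^ (c + d) ≡⟨ sym (*-distribʳ-+ (suc n ^ (c + d)) c d) ⟩
    (c + d) * suc n ^ (c + d)               ∎
    where open ≤-Reasoning

  poly-* : ∀ {f g} → PolyBounded f → PolyBounded g → PolyBounded (λ n → f n * g n)
  poly-* (c , f≤) (d , g≤) = c * d + (c + d) , λ n → begin
    _                                       ≤⟨ *-mono-≤ (f≤ n) (g≤ n) ⟩
    c * suc n ^ c * (d * suc n ^ d)         ≡⟨ rearrange c d (suc n ^ c) (suc n ^ d) ⟩
    c * d * (suc n ^ c * suc n ^ d)         ≡⟨ cong (c * d *_) (sym (^-distribˡ-+-* (suc n) c d)) ⟩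
    c * d * suc n ^ (c + d)                 ≤⟨ *-mono-≤ (m≤m+n (c * d) (c + d)) (^-monoʳ-≤ (suc n) (m≤n+m (c + d) (c * d))) ⟩
    (c * d + (c + d)) * suc n ^ (c * d + (c + d)) ∎
    where
    open ≤-Reasoning
    rearrange : ∀ c d x y → c * x * (d * y) ≡ c * d * (x * y)
    rearrange = solve-∀

  poly-pow : ∀ c → PolyBounded (λ n → suc n ^ c)
  poly-pow c = suc c , λ n → ≤-trans (^-monoʳ-≤ (suc n) (n≤1+n c)) (m≤m+n (suc n ^ suc c) (c * suc n ^ suc c))

  bounded⇒poly : ∀ {f} c → (∀ n → f n ≤ c * n ^ c + c) → PolyBounded f
  bounded⇒poly {f} c f≤ = poly-≤ (λ n → ≤-trans (f≤ n) (+-mono-≤ (*-monoʳ-≤ c (^-monoˡ-≤ c (n≤1+n n)))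
                                                          (≤-trans (≤-reflexive (sym (*-identityʳ c))) (*-monoʳ-≤ c (m^n>0 (suc n) c)))))
    (poly-+ (poly-* (poly-const c) (poly-pow c)) (poly-* (poly-const c) (poly-pow c)))

  poly⇒bounded : ∀ {f} → PolyBounded f → Σ ℕ λ c → ∀ n → f n ≤ c * n ^ c + c
  poly⇒bounded {f} (c , f≤) = c′ , bound
    where
    c′ = c * 2 ^ c + c

    2+m^c≤ : ∀ m c → suc (suc m) ^ c ≤ 2 ^ c * suc m ^ c
    2+m^c≤ m zero = ≤-refl
    2+m^c≤ m (suc c) = ≤-trans (*-mono-≤ (s≤s (m≤n+m (suc m) m)) (2+m^c≤ m c))
                               (≤-reflexive (rearrange (suc m) (2 ^ c) (suc m ^ c)))
      where
      rearrange : ∀ a x y → (a + a) * (x * y) ≡ (2 * x) * (a * y)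
      rearrange = solve-∀

    bound : ∀ n → f n ≤ c′ * n ^ c′ + c′
    bound zero = begin
      f 0            ≤⟨ f≤ 0 ⟩
      c * 1 ^ c      ≡⟨ trans (cong (c *_) (^-zeroˡ c)) (*-identityʳ c) ⟩
      c              ≤⟨ m≤n+m c (c * 2 ^ c) ⟩
      c′             ≤⟨ m≤n+m c′ (c′ * 0 ^ c′) ⟩
      c′ * 0 ^ c′ + c′ ∎
      where open ≤-Reasoning
    bound (suc m) = begin
      f (suc m)                   ≤⟨ f≤ (suc m) ⟩
      c * suc (suc m) ^ c         ≤⟨ *-monoʳ-≤ c (2+m^c≤ m c) ⟩
      c * (2 ^ c * suc m ^ c)     ≡⟨ sym (*-assoc c (2 ^ c) _) ⟩
      c * 2 ^ c * suc m ^ c       ≤⟨ *-mono-≤ (m≤m+n (c * 2 ^ c) c) (^-monoʳ-≤ (suc m) (m≤n+m c (c * 2 ^ c))) ⟩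
      c′ * suc m ^ c′             ≤⟨ m≤m+n _ c′ ⟩
      c′ * suc m ^ c′ + c′        ∎
      where open ≤-Reasoning

module ProgramSize (p : ℕ) .{{_ : NonZero p}} where
  open import Data.Nat using (_+_; _*_)
  open import Data.Nat.Properties

  length-concatMap≤ : ∀ {A B : Set} (h : A → List B) k → (∀ x → length (h x) ≤ k) →
                      ∀ xs → length (concatMap h xs) ≤ length xs * k
  length-concatMap≤ h k h≤ [] = z≤n
  length-concatMap≤ h k h≤ (x ∷ xs) = ≤-trans (≤-reflexive (List.length-++ (h x))) (+-mono-≤ (h≤ x) (length-concatMap≤ h k h≤ xs))

  open LinearPrograms p

  size : ∀ {n m} → Program n m → ℕ
  size end = 0
  size (x ◁ P) = suc (length x + size P)

  absize-toABP : ∀ {n m} (P : Program n m) → ABP.absize (toABP P) ≡ suc (size P)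
  absize-toABP P = cong suc (nodes+edges P)
    where
    nodes+edges : ∀ {n m} (P : Program n m) → m + length (edgesOf P) ≡ size P
    nodes+edges end = refl
    nodes+edges {m = suc m} (x ◁ P) = cong suc (begin
      m + length (map shiftEdge (edgesOf P) ++ map rootEdge x)
        ≡⟨ cong (m +_) (trans (List.length-++ (map shiftEdge (edgesOf P)))
                              (cong₂ _+_ (List.length-map shiftEdge (edgesOf P)) (List.length-map rootEdge x))) ⟩
      m + (length (edgesOf P) + length x)
        ≡⟨ rearrange m (length (edgesOf P)) (length x) ⟩
      length x + (m + length (edgesOf P))
        ≡⟨ cong (length x +_) (nodes+edges P) ⟩
      length x + size P ∎)
      where
      open ≡-Reasoning
      rearrange : ∀ a b c → a + (b + c) ≡ c + (a + b)
      rearrange = solve-∀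

  size-graft : ∀ {n m₁ m₂} (X : Program n m₁) (Q : Program n m₂) w → size (graft X Q w) ≡ size X + size Q
  size-graft end Q w = refl
  size-graft (x ◁ X) Q w = cong suc (trans (cong₂ _+_ (List.length-map _ x) (size-graft X Q w)) (sym (+-assoc (length x) (size X) (size Q))))

  ‖_‖ : ∀ {n} → SomeProgram n → ℕ
  ‖ _ , P ‖ = size P

  ‖⊕‖ : ∀ {n} (X Q : SomeProgram n) → ‖ X ⊕ Q ‖ ≡ 3 + (‖ X ‖ + ‖ Q ‖)
  ‖⊕‖ (m₁ , X) (m₂ , Q) = cong (3 +_) (size-graft X Q (fromℕ m₂))

  ‖mulSub‖ : ∀ {n} (X : SomeProgram n) s Q → ‖ mulSub X s Q ‖ ≡ 3 + (‖ X ‖ + ‖ Q ‖)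
  ‖mulSub‖ (m₁ , X) s (m₂ , Q) = cong (3 +_) (size-graft X Q fzero)

  ‖∏-sub‖≤ : ∀ {n} K (fs : List (SomeProgram n × Fin p)) → All (λ (X , _) → ‖ X ‖ ≤ K) fs →
             ‖ ∏-sub fs ‖ ≤ length fs * (3 + K)
  ‖∏-sub‖≤ K [] [] = z≤n
  ‖∏-sub‖≤ K ((X , s) ∷ fs) (X≤ ∷ fs≤) = begin
    ‖ mulSub X s (∏-sub fs) ‖      ≡⟨ ‖mulSub‖ X s (∏-sub fs) ⟩
    3 + (‖ X ‖ + ‖ ∏-sub fs ‖)     ≤⟨ +-monoʳ-≤ 3 (+-mono-≤ X≤ (‖∏-sub‖≤ K fs fs≤)) ⟩
    3 + (K + length fs * (3 + K))  ≡⟨ +-assoc 3 K _ ⟨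
    (3 + K) + length fs * (3 + K)  ∎
    where open ≤-Reasoning

  ‖∑ᵖ‖≤ : ∀ {n} K k (P : Fin k → SomeProgram n) → (∀ i → ‖ P i ‖ ≤ K) → ‖ ∑ᵖ k P ‖ ≤ k * (3 + K) + 1
  ‖∑ᵖ‖≤ K zero P P≤ = s≤s z≤n
  ‖∑ᵖ‖≤ K (suc k) P P≤ = begin
    ‖ P fzero ⊕ ∑ᵖ k (P ∘ fsuc) ‖                ≡⟨ ‖⊕‖ (P fzero) (∑ᵖ k (P ∘ fsuc)) ⟩
    3 + (‖ P fzero ‖ + ‖ ∑ᵖ k (P ∘ fsuc) ‖)
      ≤⟨ +-monoʳ-≤ 3 (+-mono-≤ (P≤ fzero) (‖∑ᵖ‖≤ K k (P ∘ fsuc) (P≤ ∘ fsuc))) ⟩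
    3 + (K + (k * (3 + K) + 1))                  ≡⟨ rearrange K (k * (3 + K)) ⟩
    (3 + K) + k * (3 + K) + 1                    ∎
    where
    open ≤-Reasoning
    rearrange : ∀ a b → 3 + (a + (b + 1)) ≡ (3 + a) + b + 1
    rearrange = solve-∀

module CircuitSize (p : ℕ) .{{_ : NonZero p}} where
  open import Data.Nat using (_+_; _*_)
  open import Data.Nat.Properties hiding (_≟_)
  open PairAlgebra p
  open LinearPrograms p
  open ProgramSize p
  open AffineForms p

  length-affineTerms : ∀ {n m} (a : Affine n) (t : Fin (suc m)) → length (affineTerms a t) ≤ suc (n * p)
  length-affineTerms {n} (c , r) t = s≤s (≤-trans
    (length-concatMap≤ _ p (λ i → ≤-trans (≤-reflexive (List.length-replicate (toℕ (r i)))) (<⇒≤ (Fin.toℕ<n (r i)))) (allFin n))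
    (≤-reflexive (cong (_* p) (List.length-tabulate {n = n} id))))

  module _ {n : ℕ} (ι : Bool → E) where
    open CircuitToProgram p {n} ι

    length-aNode : ∀ {j} (zs : Fin j → Affine n) g → length (aNode zs g) ≤ 3 + n * p
    length-aNode {j} zs (input i) = ≤-trans (length-affineTerms (affine-input i (π₁ (ι false)) (π₁ (ι true))) (fromℕ j)) (m≤n+m _ 2)
    length-aNode zs (const a) = s≤s z≤n
    length-aNode zs (gate 0F args) = m≤m+n 3 (n * p)
    length-aNode zs (gate 1F args) = s≤s (≤-trans (length-affineTerms (zs (args 2F)) _) (m≤n+m _ 1))

    size-aProgram : ∀ {j} (C : Circuit 𝔸 n j) → size (aProgram C) ≤ j * (4 + n * p)
    size-aProgram [] = z≤n
    size-aProgram (C ▷ g) = s≤s (+-mono-≤ (length-aNode (zForm C) g) (size-aProgram C))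

  module _ {n : ℕ} (g : ABP p n) where
    open FromABP g

    size-suffix : ∀ k → size (suffix k) ≤ k * suc (length (ABP.edges g))
    size-suffix zero = z≤n
    size-suffix (suc k) = s≤s (+-mono-≤ length-outgoing (size-suffix k))
      where
      at-most-one : ∀ e → length (if does (Edge.from e ≟ vertex (suc k)) then (Edge.label e , local k (Edge.to e)) ∷ [] else []) ≤ 1
      at-most-one e with does (Edge.from e ≟ vertex (suc k))
      ... | true = ≤-refl
      ... | false = z≤n
      length-outgoing : length (outgoing k) ≤ length (ABP.edges g)
      length-outgoing = ≤-trans (length-concatMap≤ _ 1 at-most-one (ABP.edges g)) (≤-reflexive (*-identityʳ _))

  module _ {n : ℕ} where
    open ProgramToCircuit p

    termGates≡ : ∀ {m} (ts : Node n m) k → termGates ts k ≡ 2 * length ts + k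
    termGates≡ [] k = refl
    termGates≡ (_ ∷ ts) k = trans (termGates≡ ts (suc (suc k))) (rearrange (length ts) k)
      where
      rearrange : ∀ a k → 2 * a + suc (suc k) ≡ 2 * suc a + k
      rearrange = solve-∀

    gateCount≤ : ∀ {m} (P : Program n m) → gateCount P ≤ 2 * size P
    gateCount≤ end = z≤n
    gateCount≤ (x ◁ P) = begin
      termGates x (suc (gateCount P))   ≡⟨ termGates≡ x _ ⟩
      2 * length x + suc (gateCount P)  ≤⟨ +-monoʳ-≤ (2 * length x) (s≤s (gateCount≤ P)) ⟩
      2 * length x + suc (2 * size P)   ≤⟨ m≤m+n _ 1 ⟩
      2 * length x + suc (2 * size P) + 1 ≡⟨ rearrange (length x) (size P) ⟩
      2 * suc (length x + size P)       ∎
      where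
      open ≤-Reasoning
      rearrange : ∀ a b → 2 * a + suc (2 * b) + 1 ≡ 2 * suc (a + b)
      rearrange = solve-∀

open PolynomialBounds

-- The two simulations

module Acceptors (p : ℕ) .{{_ : NonZero p}} where
  open IntegersModulo p
  open PairAlgebra p
  open LinearPrograms p
  open AffineForms p
  private module R = CommutativeRing ℤₚ

  isNonzero : Fin p → Bool
  isNonzero x = not (does (x ≟ 0#))

  isNonzero⇔ : ∀ x → isNonzero x ≡ true ⇔ x ≢ 0#
  isNonzero⇔ x with x ≟ 0#
  ... | yes x≡0 = mk⇔ (λ ()) (λ x≢0 → ⊥-elim (x≢0 x≡0))
  ... | no x≢0 = mk⇔ (λ _ → x≢0) (λ _ → refl)

  out-∏-sub-pairs : ∀ {n} (X Y : SomeProgram n) ss ts b →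
    out (∏-sub (map (X ,_) ss ++ map (Y ,_) ts)) b ≡ ∏ (map (λ s → out X b - s) ss) * ∏ (map (λ s → out Y b - s) ts)
  out-∏-sub-pairs X Y ss ts b = begin
    out (∏-sub (map (X ,_) ss ++ map (Y ,_) ts)) b
      ≡⟨ out-∏-sub (map (X ,_) ss ++ map (Y ,_) ts) b ⟩
    ∏ (map (λ (Z , s) → out Z b - s) (map (X ,_) ss ++ map (Y ,_) ts))
      ≡⟨ trans (cong ∏ (List.map-++ _ (map (X ,_) ss) (map (Y ,_) ts))) (∏-++ (map (λ (Z , s) → out Z b - s) (map (X ,_) ss)) _) ⟩
    ∏ (map (λ (Z , s) → out Z b - s) (map (X ,_) ss)) * ∏ (map (λ (Z , s) → out Z b - s) (map (Y ,_) ts))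
      ≡⟨ cong₂ _*_ (cong ∏ (sym (List.map-∘ ss))) (cong ∏ (sym (List.map-∘ ts))) ⟩
    ∏ (map (λ s → out X b - s) ss) * ∏ (map (λ s → out Y b - s) ts) ∎
    where open ≡-Reasoning

  module Acceptor {n} (ι : Bool → E) (S : E → Bool) {s} (C : Circuit 𝔸 n (suc s)) where
    open CircuitToProgram p {n} ι

    zPart aPart : SomeProgram n
    zPart = 1 , (affineTerms (zForm C (fromℕ s)) fzero ◁ end)
    aPart = suc s , aProgram C

    acceptor : SomeProgram n
    acceptor = ∑ᵖ p λ β → ∏-sub (map (zPart ,_) (vanishing (λ z → does (z ≟ β)))
                               ++ map (aPart ,_) (vanishing (λ a → S ⟨ a , β ⟩)))

    out-acceptor : ∀ b → let o = output 𝔸 C (inputs b) in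
      out acceptor b ≡ ∑[ β < p ] (indicator (λ z → does (z ≟ β)) (π₂ o) * indicator (λ a → S ⟨ a , β ⟩) (π₁ o))
    out-acceptor b = trans (out-∑ᵖ p _ b) (sum-cong-≗ λ β →
      trans (out-∏-sub-pairs zPart aPart (vanishing (λ z → does (z ≟ β))) (vanishing (λ a → S ⟨ a , β ⟩)) b)
            (cong₂ (λ z a → ∏ (map (λ t → z - t) (vanishing (λ z → does (z ≟ β))))
                          * ∏ (map (λ t → a - t) (vanishing (λ a → S ⟨ a , β ⟩))))
                   out-zPart (π₁-output C b)))
      where
      out-zPart : out zPart b ≡ π₂ (output 𝔸 C (inputs b))
      out-zPart = trans (nodeValue-affineTerms (zForm C (fromℕ s)) fzero b (λ _ → 1#))
                           (trans (R.*-identityʳ _) (π₂-output C b))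

  module Rejector {n} (g : ABP p n) (accept : Fin p → Bool) where
    open FromABP g
    open ProgramToCircuit p

    rejector : SomeProgram n
    rejector = ∏-sub (map ((ABP.v g , fromABP) ,_) (vanishing accept))

    circuit : Circuit 𝔸 n (suc (gateCount (proj₂ rejector)))
    circuit = compile (proj₂ rejector)

    π₁-output-circuit : ∀ b → π₁ (output 𝔸 circuit (inputs₀ b)) ≡ indicator accept (abpEval g b)
    π₁-output-circuit b = trans (π₁-output-compile (proj₂ rejector) b)
      (trans (out-∏-sub (map ((ABP.v g , fromABP) ,_) (vanishing accept)) b)
      (trans (cong ∏ (sym (List.map-∘ (vanishing accept))))
             (cong (λ y → ∏ (map (λ s → y - s) (vanishing accept))) (value-fromABP b))))

module AcceptorSizes (p : ℕ) .{{_ : NonZero p}} where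
  open IntegersModulo p using (vanishing)
  open PairAlgebra p using (E; 𝔸; ⟨_,_⟩)
  open LinearPrograms p using (SomeProgram; ∏-sub; ∑ᵖ)
  open ProgramSize p
  open CircuitSize p
  open ProgramToCircuit p using (gateCount)
  open Acceptors p
  open import Data.Nat using (_+_; _*_)

  length-vanishing : ∀ P → length (vanishing P) ≤ p
  length-vanishing P = ℕ.≤-trans (List.length-filter (T? ∘ not ∘ P) (allFin p)) (ℕ.≤-reflexive (List.length-tabulate id))

  acceptorBound : ℕ → ℕ → ℕ
  acceptorBound n s = p * (3 + (p + p) * (3 + ((2 + n * p) + suc s * (4 + n * p)))) + 1

  ‖acceptor‖≤ : ∀ {n} (ι : Bool → E) S {s} (C : Circuit 𝔸 n (suc s)) → ‖ Acceptor.acceptor ι S C ‖ ≤ acceptorBound n s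
  ‖acceptor‖≤ {n} ι S {s} C = ‖∑ᵖ‖≤ ((p + p) * (3 + K₀)) p (λ β → ∏-sub (factors β)) λ β →
    ℕ.≤-trans (‖∏-sub‖≤ K₀ (factors β) (All.++⁺ (All.map⁺ (All.universal (λ _ → zPart≤) (zs β)))
                                                 (All.map⁺ (All.universal (λ _ → aProgram≤) (as β)))))
              (ℕ.*-monoˡ-≤ (3 + K₀) (length-factors β))
    where
    open Acceptor ι S C
    open CircuitToProgram p {n} ι using (zForm)
    K₀ = (2 + n * p) + suc s * (4 + n * p)
    zPart≤ : ‖ zPart ‖ ≤ K₀
    zPart≤ = ℕ.≤-trans (s≤s (ℕ.≤-trans (ℕ.≤-reflexive (ℕ.+-identityʳ _)) (length-affineTerms (zForm C (fromℕ s)) (fzero {0}))))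
                       (ℕ.m≤m+n (2 + n * p) _)
    aProgram≤ : ‖ aPart ‖ ≤ K₀
    aProgram≤ = ℕ.≤-trans (size-aProgram ι C) (ℕ.m≤n+m (suc s * (4 + n * p)) (2 + n * p))
    zs as : Fin p → List (Fin p)
    zs β = vanishing (λ z → does (z ≟ β))
    as β = vanishing (λ a → S ⟨ a , β ⟩)
    factors : Fin p → List (SomeProgram n × Fin p)
    factors β = map (zPart ,′_) (zs β) ++ map (aPart ,′_) (as β)
    length-factors : ∀ β → length (factors β) ≤ p + p
    length-factors β = ℕ.≤-trans (ℕ.≤-reflexive (trans (List.length-++ (map (zPart ,′_) (zs β)) {map (aPart ,′_) (as β)})
                                                       (cong₂ _+_ (List.length-map (zPart ,′_) (zs β)) (List.length-map (aPart ,′_) (as β)))))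
                                 (ℕ.+-mono-≤ (length-vanishing (λ z → does (z ≟ β))) (length-vanishing (λ a → S ⟨ a , β ⟩)))

  acceptorBound-poly : ∀ {s : ℕ → ℕ} → PolyBounded (λ n → suc (s n)) → PolyBounded (λ n → suc (acceptorBound n (s n)))
  acceptorBound-poly 1+s = poly-+ (poly-const 1) (poly-+ (poly-* (poly-const p) (poly-+ (poly-const 3) (poly-* (poly-const (p + p))
    (poly-+ (poly-const 3) (poly-+ (poly-+ (poly-const 2) n*p) (poly-* 1+s (poly-+ (poly-const 4) n*p))))))) (poly-const 1))
    where
    n*p : PolyBounded (λ n → n * p)
    n*p = poly-* poly-id (poly-const p)

  rejectorBound : ℕ → ℕ
  rejectorBound a = 2 * (p * (3 + a * suc a))

  gateCount-rejector≤ : ∀ {n} (g : ABP p n) accept →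
    ProgramToCircuit.gateCount p (proj₂ (Rejector.rejector g accept)) ≤ rejectorBound (ABP.absize g)
  gateCount-rejector≤ {n} g accept = ℕ.≤-trans (gateCount≤ (proj₂ rejector)) (ℕ.*-monoʳ-≤ 2 (begin
    ‖ rejector ‖
      ≤⟨ ‖∏-sub‖≤ _ _ (All.map⁺ (All.universal (λ _ → ℕ.≤-refl) (vanishing accept))) ⟩
    length (map _ (vanishing accept)) * (3 + size fromABP)
      ≡⟨ cong (_* (3 + size fromABP)) (List.length-map _ (vanishing accept)) ⟩
    length (vanishing accept) * (3 + size fromABP)
      ≤⟨ ℕ.*-mono-≤ (length-vanishing accept) (ℕ.+-monoʳ-≤ 3 size-fromABP≤) ⟩
    p * (3 + a * suc a) ∎))
    where
    open ℕ.≤-Reasoning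
    open Rejector g accept
    open LinearPrograms.FromABP p g using (fromABP)
    a = ABP.absize g
    v≤a : ABP.v g ≤ a
    v≤a = ℕ.≤-trans (ℕ.n≤1+n _) (ℕ.m≤m+n _ _)
    edges≤a : length (ABP.edges g) ≤ a
    edges≤a = ℕ.m≤n+m _ _
    size-fromABP≤ : size fromABP ≤ a * suc a
    size-fromABP≤ = ℕ.≤-trans (size-suffix g (ABP.v g)) (ℕ.*-mono-≤ v≤a (s≤s edges≤a))

  rejectorBound-poly : ∀ {a : ℕ → ℕ} → PolyBounded a → PolyBounded (λ n → suc (rejectorBound (a n)))
  rejectorBound-poly a = poly-+ (poly-const 1) (poly-* (poly-const 2) (poly-* (poly-const p)
    (poly-+ (poly-const 3) (poly-* a (poly-+ (poly-const 1) a)))))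

module Recognition (p : ℕ) .{{_ : NonZero p}} (p-prime : Prime p) (L : List Bool → Set) where
  open IntegersModulo p using (0#; _*_; indicator; sum-syntax)
  open IntegersModulo.Field p p-prime using (interpolation; indicator≢0#⇔)
  open PairAlgebra p using (𝔸; ⟨_,_⟩; π₁; π₂; ⟨π₁,π₂⟩)
  open LinearPrograms p using (toABP; abpEval-toABP; out)
  open ProgramSize p using (absize-toABP)
  open Acceptors p
  open AcceptorSizes p
  open import Relation.Binary.Reasoning.Setoid (⇔-setoid 0ℓ)

  ×⇒⇔ : ∀ {A B : Set} → (A → B) × (B → A) → A ⇔ B
  ×⇒⇔ (to , from) = mk⇔ to from

  ⇔⇒× : ∀ {A B : Set} → A ⇔ B → (A → B) × (B → A)
  ⇔⇒× A⇔B = Equivalence.to A⇔B , Equivalence.from A⇔B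

  nuP⇒nuDet : nuP 𝔸 L → nuDet p L
  nuP⇒nuDet (ι , S , s , t , (c , t-small) , t-correct) = abp , (λ _ → isNonzero) , abp-small , abp-correct
    where
    module Acc n = Acceptor {n} ι S (t n)

    abp : (n : ℕ) → ABP p n
    abp n = toABP (proj₂ (Acc.acceptor n))

    abp-small : Σ ℕ λ c → ∀ n → ABP.absize (abp n) ≤ c ℕ.* n ℕ.^ c ℕ.+ c
    abp-small = poly⇒bounded (poly-≤ (λ n → ℕ.≤-trans (ℕ.≤-reflexive (absize-toABP _)) (s≤s (‖acceptor‖≤ ι S (t n))))
                                     (acceptorBound-poly (bounded⇒poly c t-small)))

    abp-correct : ∀ n (b : Vec Bool n) → (L (toList b) → isNonzero (abpEval (abp n) b) ≡ true)
                                       × (isNonzero (abpEval (abp n) b) ≡ true → L (toList b))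
    abp-correct n b = ⇔⇒× (begin
      L (toList b)                                    ≈⟨ ×⇒⇔ (t-correct n b) ⟩
      S o ≡ true                                      ≈⟨ T-≡ ⟨
      T (S o)                                         ≡⟨ cong (T ∘ S) (⟨π₁,π₂⟩ o) ⟨
      T (S ⟨ π₁ o , π₂ o ⟩)                            ≈⟨ interpolation (λ a z → S ⟨ a , z ⟩) (π₁ o) (π₂ o) ⟨
      ∑[ β < p ] (indicator (λ z → does (z ≟ β)) (π₂ o) * indicator (λ a → S ⟨ a , β ⟩) (π₁ o)) ≢ 0#
        ≡⟨ cong (_≢ 0#) (trans (abpEval-toABP (proj₂ (Acc.acceptor n)) b) (Acc.out-acceptor n b)) ⟨
      abpEval (abp n) b ≢ 0#                          ≈⟨ isNonzero⇔ _ ⟨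
      isNonzero (abpEval (abp n) b) ≡ true            ∎)
      where o = output 𝔸 (t n) (λ i → ι (lookup b i))

  nuDet⇒nuP : nuDet p L → nuP 𝔸 L
  nuDet⇒nuP (g , accept , (c , g-small) , g-correct) = ι₀ , isNonzero ∘ π₁ , gates , circuit , circuit-small , circuit-correct
    where
    module Rej n = Rejector (g n) (accept n)
    open ProgramToCircuit p using (ι₀; gateCount)

    gates : ℕ → ℕ
    gates n = gateCount (proj₂ (Rej.rejector n))

    circuit : (n : ℕ) → Circuit 𝔸 n (suc (gates n))
    circuit n = Rej.circuit n

    circuit-small : Σ ℕ λ c → ∀ n → suc (gates n) ≤ c ℕ.* n ℕ.^ c ℕ.+ c
    circuit-small = poly⇒bounded (poly-≤ (λ n → s≤s (gateCount-rejector≤ (g n) (accept n)))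
                                         (rejectorBound-poly (bounded⇒poly c g-small)))

    circuit-correct : ∀ n (b : Vec Bool n) → (L (toList b) → isNonzero (π₁ (output 𝔸 (circuit n) (λ i → ι₀ (lookup b i)))) ≡ true)
                                           × (isNonzero (π₁ (output 𝔸 (circuit n) (λ i → ι₀ (lookup b i)))) ≡ true → L (toList b))
    circuit-correct n b = ⇔⇒× (begin
      L (toList b)                                   ≈⟨ ×⇒⇔ (g-correct n b) ⟩
      accept n (abpEval (g n) b) ≡ true              ≈⟨ T-≡ ⟨
      T (accept n (abpEval (g n) b))                 ≈⟨ indicator≢0#⇔ (accept n) (abpEval (g n) b) ⟨
      indicator (accept n) (abpEval (g n) b) ≢ 0#    ≡⟨ cong (_≢ 0#) (Rej.π₁-output-circuit n b) ⟨
      π₁ o ≢ 0#                                      ≈⟨ isNonzero⇔ (π₁ o) ⟨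
      isNonzero (π₁ o) ≡ true                        ∎)
      where o = output 𝔸 (circuit n) (λ i → ι₀ (lookup b i))

mainTheorem4 : ∀ (p : ℕ) .{{_ : NonZero p}} → Prime p →
    Σ FiniteAlgebra λ A → Malcev A × Solvable A ×
      (∀ (L : List Bool → Set) → (nuP A L → nuDet p L) × (nuDet p L → nuP A L))
mainTheorem4 p p-prime = 𝔸 , malcev , solvable , λ L → nuP⇒nuDet L , nuDet⇒nuP L
  where
  open PairAlgebra p
  open Recognition p p-prime
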